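{- Let $G$ be a finite simple graph with $\operatorname{Mad}(G) < \frac{5}{2}$. Then $G$ has an I,F-partition, i.e., $V(G)$ can be partitioned as $\mathcal{I} \sqcup \mathcal{F}$ where $\mathcal{I}$ is a 2-independent set in $G$ and the induced subgraph $G[\mathcal{F}]$ is a forest.
   Context: All graphs are finite and simple. The maximum average degree of $G$ is $\operatorname{Mad}(G) = \max_{H \subseteq G} \frac{2|E(H)|}{|V(H)|}$, the maximum over nonempty subgraphs $H$ of $G$. A 2-independent set in $G$ is a set of vertices whose pairwise distances in $G$ are all greater than $2$ (so no two are adjacent or have a common neighbor). -}

module Defs where

open import Data.Nat using (ℕ; zero; suc; _+_; _*_; _<_; _≤_)
open import Data.Nat.Properties using (_<?_)
open import Data.Bool using (Bool; true; false; T; if_then_else_; not)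
open import Data.Fin using (Fin; toℕ; inject₁; fromℕ)
open import Data.Product using (Σ; _×_; ∃; ∃-syntax)
open import Data.Empty using (⊥)
open import Relation.Nullary using (¬_; does)
open import Relation.Binary.PropositionalEquality using (_≡_)
open import Function.Definitions using (Injective)

record Graph (n : ℕ) : Set where
  field
    Adj   : Fin n → Fin n → Bool
    sym   : ∀ u v → Adj u v ≡ Adj v u
    irrefl : ∀ v → Adj v v ≡ false
open Graph public

Adjacent : ∀ {n} → Graph n → Fin n → Fin n → Set
Adjacent G u v = T (Adj G u v)

sumFin : ∀ {n} → (Fin n → ℕ) → ℕ
sumFin {zero} f = 0
sumFin {suc n} f = f Fin.zero + sumFin (λ i → f (Fin.suc i))

count : ∀ {n} → (Fin n → Bool) → ℕ
count P = sumFin (λ i → if P i then 1 else 0)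

record Subgraph {n : ℕ} (G : Graph n) : Set where
  field
    VH : Fin n → Bool
    EH : Fin n → Fin n → Bool
    EH-sym : ∀ u v → EH u v ≡ EH v u
    EH⊆G : ∀ u v → T (EH u v) → T (Adj G u v)
    EH-ends : ∀ u v → T (EH u v) → T (VH u) × T (VH v)
open Subgraph public

nV : ∀ {n} {G : Graph n} → Subgraph G → ℕ
nV H = count (VH H)

nE : ∀ {n} {G : Graph n} → Subgraph G → ℕ
nE H = sumFin (λ u → sumFin (λ v →
         if does (toℕ u <? toℕ v) then (if EH H u v then 1 else 0) else 0))

-- Mad(G) < 5/2 :  every nonempty subgraph H has 2|E(H)|/|V(H)| < 5/2,
-- written with cleared denominators as 4|E(H)| < 5|V(H)|
MadLessFiveHalves : ∀ {n} → Graph n → Set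
MadLessFiveHalves G = ∀ (H : Subgraph G) → 0 < nV H → 4 * nE H < 5 * nV H

-- 2-independent set: distinct members are at distance > 2
TwoIndependent : ∀ {n} → Graph n → (Fin n → Bool) → Set
TwoIndependent G I = ∀ u v → T (I u) → T (I v) → ¬ (u ≡ v) →
  ¬ Adjacent G u v × (∀ w → ¬ (Adjacent G u w × Adjacent G w v))

record CycleIn {n : ℕ} (G : Graph n) (S : Fin n → Bool) : Set where
  field
    len : ℕ
    vtx : Fin (suc (suc (suc len))) → Fin n
    inj : Injective _≡_ _≡_ vtx
    inS : ∀ i → T (S (vtx i))
    step : ∀ (i : Fin (suc (suc len))) → Adjacent G (vtx (inject₁ i)) (vtx (Fin.suc i))
    close : Adjacent G (vtx (fromℕ (suc (suc len)))) (vtx Fin.zero)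

InducedForest : ∀ {n} → Graph n → (Fin n → Bool) → Set
InducedForest G S = ¬ CycleIn G S

IFPartition : ∀ {n : ℕ} → Graph n → Set
IFPartition {n} G = Σ (Fin n → Bool) λ I →
  TwoIndependent G I × InducedForest G (λ v → not (I v))

{-# OPTIONS --safe #-}
module Submission where

-- Discharging on potentials. A vertex carries a state saying what it may still become, of weight 5 (free), 4 (forced into
-- the forest), 3 (in I, or in F without neighbours in I) or 2 (in F without neighbours in I), and an edge costs 4; every
-- nonempty vertex set has positive potential. Induct on the number of vertices.
-- If a proper subset A with at least two vertices has potential at most 2, colour A, contract it to one vertex of weight 2,
-- give weight 2 to the neighbours of A ∩ I, and colour the rest; when the potential is exactly 2, first force a boundary
-- vertex of A into F, which pays for the only set whose potential could drop to 0, the complement of A.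
-- Otherwise all these subsets have potential at least 3. This slack makes reducible every vertex of degree at most 1, every
-- free 2-vertex with a neighbour of weight 3, or with two neighbours of weight at least 4 one of which has degree 2, and
-- every free 3-vertex with three free 2-neighbours. In terms of the charge 2 deg - weight, let each free 2-vertex receive
-- 1/2 from every neighbour of weight at least 4 and degree at least 3, and 1 from every neighbour of weight 2: all charges
-- become nonnegative, so the total potential is at most 0.

-- The four live states combine two demands: "in the forest" lowers the weight 5 by 1, and "no
-- neighbour in I if in the forest" lowers it by 2. Laying demands on surviving vertices thus costs
-- at most 1, 2 or 3, and slack must pay. The constants 5 and 4 come from 4|E| < 5|V|. A contracted
-- set `A` becomes a vertex in state D because weight 2 is at least the potential of `A`, because D
-- keeps I away from the forest part of `A`, and because the forest must still see connections
-- running through `A`. Potential 1 is treated before potential 2: as 1 is the least possible value,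
-- no superset of `A` lies below `A`. Once those sets are gone, 2 is the least value on proper
-- subsets with two vertices or more, and a union with `A` can drop to 1 only if it is the whole
-- vertex set. Contraction alters the graph, so the induction ranges over all graphs on the same
-- vertex type; deletion is a state, and the live vertices are counted. No minimal counterexample is
-- assumed: the case splits are decidable, and each vertex yields either a colouring or its charge
-- inequality.

open import Data.Bool using (Bool; true; false; if_then_else_; _∧_; _∨_; not; T)
import Data.Bool.Properties as Bool
open import Data.Empty using (⊥; ⊥-elim)
open import Data.Fin using (Fin; zero; suc; toℕ; fromℕ; inject₁)
open import Data.Fin.Properties using (_≟_; any?; all?; toℕ-inject₁; toℕ-injective)
open import Data.Fin.Relation.Unary.Top using (view; ‵fromℕ; ‵inject₁)
open import Data.Fin.Subset.Properties using (anySubset?)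
open import Data.List using ([]; _∷_)
open import Data.Nat using (ℕ; zero; suc; _+_; _*_; _≤_; _<_; _≤ᵇ_; _<ᵇ_; _≡ᵇ_; z≤n; s≤s)
open import Data.Nat.Properties hiding (_≟_)
open import Data.Nat.Tactic.RingSolver using (solve)
open import Data.Product using (∃; ∃₂; _×_; _,_; proj₁; proj₂)
open import Data.Sum using (_⊎_; inj₁; inj₂)
open import Data.Vec using (lookup; tabulate)
open import Data.Vec.Properties using (lookup∘tabulate)
open import Function using (_∘_)
open import Function.Bundles using (Equivalence)
open import Relation.Nullary using (¬_; Dec; yes; no; does; _×-dec_; _→-dec_; ¬?)
open import Relation.Nullary.Decidable using (dec-true)
open import Relation.Binary.PropositionalEquality using (_≡_; _≢_; refl; sym; trans; cong; cong₂; subst; subst₂)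
open import Defs hiding (sym)

-- Every linear inequality below is proved by exhibiting x + b + k ≡ y + a, where a ≤ b is the sum of the hypotheses.
linear : ∀ {a b x y} k → a ≤ b → x + b + k ≡ y + a → x ≤ y
linear {a} {b} {x} {y} k a≤b eq =
  +-cancelʳ-≤ b x y (≤-trans (m≤m+n (x + b) k) (≤-trans (≤-reflexive eq) (+-monoʳ-≤ y a≤b)))

scale : ∀ {a b} k → a ≤ b → k * a ≤ k * b
scale k = *-monoʳ-≤ k

-- Indicators, finite sums and vertex sets.

𝟙 : Bool → ℕ
𝟙 true = 1
𝟙 false = 0

𝟙≤1 : ∀ b → 𝟙 b ≤ 1
𝟙≤1 false = z≤n
𝟙≤1 true = s≤s z≤n

true≢false : ∀ {b} → b ≡ true → b ≡ false → ⊥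
true≢false refl ()

∧-true : ∀ {a b} → a ∧ b ≡ true → a ≡ true × b ≡ true
∧-true {true} {true} _ = refl , refl

∧-intro : ∀ {a b} → a ≡ true → b ≡ true → a ∧ b ≡ true
∧-intro refl refl = refl

not-true : ∀ {a} → not a ≡ true → a ≡ false
not-true {false} _ = refl

not-intro : ∀ {a} → a ≡ false → not a ≡ true
not-intro refl = refl

sum-cong : ∀ {n} {f g : Fin n → ℕ} → (∀ i → f i ≡ g i) → sumFin f ≡ sumFin g
sum-cong {zero} h = refl
sum-cong {suc n} h = cong₂ _+_ (h zero) (sum-cong (h ∘ suc))

sum-mono : ∀ {n} {f g : Fin n → ℕ} → (∀ i → f i ≤ g i) → sumFin f ≤ sumFin g
sum-mono {zero} h = z≤n
sum-mono {suc n} h = +-mono-≤ (h zero) (sum-mono (h ∘ suc))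

sum-+ : ∀ {n} (f g : Fin n → ℕ) → sumFin (λ i → f i + g i) ≡ sumFin f + sumFin g
sum-+ {zero} f g = refl
sum-+ {suc n} f g rewrite sum-+ (f ∘ suc) (g ∘ suc) =
  rearrange (f zero) (g zero) (sumFin (f ∘ suc)) (sumFin (g ∘ suc))
  where
  rearrange : ∀ a b c d → a + b + (c + d) ≡ a + c + (b + d)
  rearrange a b c d = solve (a ∷ b ∷ c ∷ d ∷ [])

sum-* : ∀ {n} k (f : Fin n → ℕ) → sumFin (λ i → k * f i) ≡ k * sumFin f
sum-* {zero} k f = sym (*-zeroʳ k)
sum-* {suc n} k f rewrite sum-* k (f ∘ suc) = sym (*-distribˡ-+ k (f zero) _)

sum-0 : ∀ {n} (f : Fin n → ℕ) → (∀ i → f i ≡ 0) → sumFin f ≡ 0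
sum-0 {zero} f h = refl
sum-0 {suc n} f h rewrite h zero = sum-0 (f ∘ suc) (h ∘ suc)

sum-swap : ∀ {m n} (f : Fin m → Fin n → ℕ) →
  sumFin (λ i → sumFin (f i)) ≡ sumFin (λ j → sumFin (λ i → f i j))
sum-swap {zero} {n} f = sym (sum-0 {n} (λ _ → 0) (λ _ → refl))
sum-swap {suc m} f rewrite sum-swap (f ∘ suc) =
  sym (sum-+ (f zero) (λ j → sumFin (λ i → f (suc i) j)))

term≤sum : ∀ {n} (f : Fin n → ℕ) x → f x ≤ sumFin f
term≤sum f zero = m≤m+n _ _
term≤sum f (suc x) = ≤-trans (term≤sum (f ∘ suc) x) (m≤n+m _ _)

sum-positive : ∀ {n} (f : Fin n → ℕ) → 0 < sumFin f → ∃ λ x → 0 < f x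
sum-positive {suc n} f p with f zero in eq
... | suc _ = zero , subst (0 <_) (sym eq) (s≤s z≤n)
... | zero with sum-positive (f ∘ suc) p
...   | x , q = suc x , q

VSet : ℕ → Set
VSet n = Fin n → Bool

infix 4 _∈_ _∉_ _⊆_

_∈_ _∉_ : ∀ {n} → Fin n → VSet n → Set
x ∈ A = A x ≡ true
x ∉ A = A x ≡ false

_⊆_ : ∀ {n} → VSet n → VSet n → Set
A ⊆ B = ∀ v → v ∈ A → v ∈ B

infix 7 _==_

_==_ : ∀ {n} → Fin n → Fin n → Bool
u == v = does (u ≟ v)

==-refl : ∀ {n} (u : Fin n) → u == u ≡ true
==-refl u with u ≟ u
... | yes _ = refl
... | no u≢u = ⊥-elim (u≢u refl)

==-false : ∀ {n} {u v : Fin n} → u ≢ v → u == v ≡ false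
==-false {u = u} {v} u≢v with u ≟ v
... | yes u≡v = ⊥-elim (u≢v u≡v)
... | no _ = refl

==-true : ∀ {n} {u v : Fin n} → u == v ≡ true → u ≡ v
==-true {u = u} {v} e with u ≟ v
... | yes u≡v = u≡v
==-true () | no _

infixr 5 _▷_

_▷_ : ∀ {n} → Fin n → VSet n → VSet n
(x ▷ A) v = v == x ∨ A v

infixl 6 _∖_

_∖_ : ∀ {n} → VSet n → Fin n → VSet n
(A ∖ x) v = A v ∧ not (v == x)

▷-here : ∀ {n} (x : Fin n) A → x ∈ x ▷ A
▷-here x A rewrite ==-refl x = refl

▷-there : ∀ {n} (x : Fin n) A v → v ∈ A → v ∈ x ▷ A
▷-there x A v v∈A rewrite v∈A with v == x
... | true = refl
... | false = refl

▷-case : ∀ {n} (x : Fin n) A v → v ∈ x ▷ A → v ≡ x ⊎ v ∈ A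
▷-case x A v p with v ≟ x
... | yes v≡x = inj₁ v≡x
... | no _ = inj₂ p

▷-∉ : ∀ {n} (x : Fin n) A v → v ≢ x → v ∉ A → v ∉ x ▷ A
▷-∉ x A v v≢x v∉A rewrite ==-false v≢x = v∉A

▷-⊆ : ∀ {n} (x : Fin n) A B → x ∈ B → A ⊆ B → (x ▷ A) ⊆ B
▷-⊆ x A B x∈B A⊆B v p with ▷-case x A v p
... | inj₁ refl = x∈B
... | inj₂ q = A⊆B v q

∖-∈ : ∀ {n} (A : VSet n) {x v} → v ∈ A → v ≢ x → v ∈ A ∖ x
∖-∈ A p v≢x = ∧-intro p (not-intro (==-false v≢x))

∖-elim : ∀ {n} (A : VSet n) {x v} → v ∈ A ∖ x → v ∈ A × v ≢ x
∖-elim A {x} {v} p with ∧-true p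
... | q , r = q , λ v≡x → true≢false (subst (λ z → z == x ≡ true) (sym v≡x) (==-refl x)) (not-true r)

-- As an identity between indicators, it splits any weighted sum over `C` by distributivity.
record DisjointUnion {n : ℕ} (C A B : VSet n) : Set where
  constructor disjoint
  field split : ∀ v → 𝟙 (C v) ≡ 𝟙 (A v) + 𝟙 (B v)
open DisjointUnion

▷-disjoint : ∀ {n} (x : Fin n) A → x ∉ A → DisjointUnion (x ▷ A) (_== x) A
▷-disjoint x A x∉A = disjoint eq
  where
  eq : ∀ v → 𝟙 ((x ▷ A) v) ≡ 𝟙 (v == x) + 𝟙 (A v)
  eq v with v ≟ x
  ... | no _ = refl
  ... | yes refl rewrite x∉A = refl

∖-disjoint : ∀ {n} (A : VSet n) x → x ∈ A → DisjointUnion A (_== x) (A ∖ x)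
∖-disjoint A x x∈A = disjoint eq
  where
  eq : ∀ v → 𝟙 (A v) ≡ 𝟙 (v == x) + 𝟙 ((A ∖ x) v)
  eq v with v ≟ x
  ... | yes refl rewrite x∈A = refl
  ... | no _ with A v
  ...   | true = refl
  ...   | false = refl

sum-δ : ∀ {n} (x : Fin n) (f : Fin n → ℕ) → sumFin (λ v → 𝟙 (v == x) * f v) ≡ f x
sum-δ {suc n} zero f = trans (cong (f zero + 0 +_) (sum-0 {n} (λ _ → 0) (λ _ → refl))) (trans (+-identityʳ _) (+-identityʳ _))
sum-δ (suc x) f = sum-δ x (f ∘ suc)

sum-union : ∀ {n} {C A B : VSet n} → DisjointUnion C A B → (f : Fin n → ℕ) →
  sumFin (λ v → 𝟙 (C v) * f v) ≡ sumFin (λ v → 𝟙 (A v) * f v) + sumFin (λ v → 𝟙 (B v) * f v)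
sum-union {A = A} {B} h f = trans
  (sum-cong (λ v → trans (cong (_* f v) (split h v)) (*-distribʳ-+ (f v) (𝟙 (A v)) (𝟙 (B v)))))
  (sum-+ (λ v → 𝟙 (A v) * f v) (λ v → 𝟙 (B v) * f v))

sum-▷ : ∀ {n} (x : Fin n) A → x ∉ A → (f : Fin n → ℕ) →
  sumFin (λ v → 𝟙 ((x ▷ A) v) * f v) ≡ f x + sumFin (λ v → 𝟙 (A v) * f v)
sum-▷ x A x∉A f = trans (sum-union (▷-disjoint x A x∉A) f) (cong (_+ sumFin (λ v → 𝟙 (A v) * f v)) (sum-δ x f))

∈⇒1* : ∀ {b} m → b ≡ true → 𝟙 b * m ≡ m
∈⇒1* m refl = +-identityʳ m

-- Degrees, cuts and edge counts.

module Potential {n : ℕ} (G : Graph n) where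

  adj : Fin n → Fin n → Bool
  adj = Adj G

  adj-sym : ∀ {u v} → adj u v ≡ true → adj v u ≡ true
  adj-sym {u} {v} p = trans (sym (Graph.sym G u v)) p

  adj-≢ : ∀ {u v} → adj u v ≡ true → u ≢ v
  adj-≢ {u} p refl = true≢false p (irrefl G u)

  deg : VSet n → Fin n → ℕ
  deg A v = sumFin (λ u → 𝟙 (A u) * 𝟙 (adj v u))

  cut : VSet n → VSet n → ℕ
  cut A B = sumFin (λ v → 𝟙 (A v) * deg B v)

  -- Twice the number of edges spanned by A.
  E : VSet n → ℕ
  E A = cut A A

  cut-sym : ∀ A B → cut A B ≡ cut B A
  cut-sym A B = trans (sum-cong (λ v → sym (sum-* (𝟙 (A v)) (λ u → 𝟙 (B u) * 𝟙 (adj v u)))))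
    (trans (sum-swap (λ v u → 𝟙 (A v) * (𝟙 (B u) * 𝟙 (adj v u))))
    (sum-cong (λ u → trans (sum-cong (λ v → lemma u v)) (sum-* (𝟙 (B u)) (λ v → 𝟙 (A v) * 𝟙 (adj u v))))))
    where
    rearrange : ∀ a b c → a * (b * c) ≡ b * (a * c)
    rearrange a b c = solve (a ∷ b ∷ c ∷ [])
    lemma : ∀ u v → 𝟙 (A v) * (𝟙 (B u) * 𝟙 (adj v u)) ≡ 𝟙 (B u) * (𝟙 (A v) * 𝟙 (adj u v))
    lemma u v rewrite Graph.sym G v u = rearrange (𝟙 (A v)) (𝟙 (B u)) (𝟙 (adj u v))

  deg-union : ∀ {C A B} → DisjointUnion C A B → ∀ v → deg C v ≡ deg A v + deg B v
  deg-union h v = sum-union h (λ u → 𝟙 (adj v u))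

  E-union : ∀ {C A B} → DisjointUnion C A B → E C ≡ E A + 2 * cut B A + E B
  E-union {C} {A} {B} h = trans (sum-union h (deg C))
    (trans (cong₂ _+_ (halve A) (halve B))
    (trans (cong (λ m → E A + m + (cut B A + E B)) (cut-sym A B)) (rearrange (E A) (cut B A) (E B))))
    where
    rearrange : ∀ a b c → a + b + (b + c) ≡ a + 2 * b + c
    rearrange a b c = solve (a ∷ b ∷ c ∷ [])
    halve : ∀ S → sumFin (λ v → 𝟙 (S v) * deg C v) ≡ cut S A + cut S B
    halve S = trans (sum-cong (λ v → trans (cong (𝟙 (S v) *_) (deg-union h v)) (*-distribˡ-+ (𝟙 (S v)) (deg A v) (deg B v))))
      (sum-+ (λ v → 𝟙 (S v) * deg A v) (λ v → 𝟙 (S v) * deg B v))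

  deg-▷ : ∀ x A → x ∉ A → ∀ v → deg (x ▷ A) v ≡ 𝟙 (adj v x) + deg A v
  deg-▷ x A x∉A v = sum-▷ x A x∉A (λ u → 𝟙 (adj v u))

  E-▷ : ∀ x A → x ∉ A → E (x ▷ A) ≡ E A + 2 * deg A x
  E-▷ x A x∉A = trans (E-union (▷-disjoint x A x∉A))
    (trans (cong₂ (λ p q → p + 2 * q + E A) single (trans (cut-sym A (_== x)) (sum-δ x (deg A))))
    (+-comm (2 * deg A x) (E A)))
    where
    single : E (_== x) ≡ 0
    single = trans (sum-δ x (deg (_== x))) (trans (sum-δ x (λ u → 𝟙 (adj x u))) (cong 𝟙 (irrefl G x)))

  deg-≥1 : ∀ A v x → x ∈ A → adj v x ≡ true → 1 ≤ deg A v
  deg-≥1 A v x x∈A a = subst (_≤ deg A v) eq (term≤sum (λ u → 𝟙 (A u) * 𝟙 (adj v u)) x)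
    where
    eq : 𝟙 (A x) * 𝟙 (adj v x) ≡ 1
    eq rewrite x∈A | a = refl

  deg-∖ : ∀ A v x → x ∈ A → deg A v ≡ 𝟙 (adj v x) + deg (A ∖ x) v
  deg-∖ A v x x∈A = trans (deg-union (∖-disjoint A x x∈A) v) (cong (_+ deg (A ∖ x) v) (sum-δ x (λ u → 𝟙 (adj v u))))

  deg-≥2 : ∀ A v x y → x ≢ y → x ∈ A → y ∈ A → adj v x ≡ true → adj v y ≡ true → 2 ≤ deg A v
  deg-≥2 A v x y x≢y x∈A y∈A ax ay rewrite deg-∖ A v x x∈A | ax =
    s≤s (deg-≥1 (A ∖ x) v y (∖-∈ A y∈A (x≢y ∘ sym)) ay)

  deg-positive : ∀ A v → 0 < deg A v → ∃ λ x → x ∈ A × adj v x ≡ true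
  deg-positive A v p with sum-positive _ p
  ... | x , q with A x in eA | adj v x in ea
  ...   | true | true = x , eA , ea

  deg-pick : ∀ {k} A v → deg A v ≡ suc k → ∃ λ x → x ∈ A × adj v x ≡ true × deg (A ∖ x) v ≡ k
  deg-pick A v eq with deg-positive A v (subst (0 <_) (sym eq) (s≤s z≤n))
  ... | x , x∈A , a = x , x∈A , a , suc-inj (trans (sym drop) eq)
    where
    suc-inj : ∀ {a b} → suc a ≡ suc b → a ≡ b
    suc-inj refl = refl
    drop : deg A v ≡ suc (deg (A ∖ x) v)
    drop = trans (deg-∖ A v x x∈A) (cong (λ b → 𝟙 b + deg (A ∖ x) v) a)

  deg-zero : ∀ A v → deg A v ≡ 0 → ∀ x → x ∈ A → adj v x ≡ true → ⊥
  deg-zero A v eq x x∈A a = <-irrefl (sym eq) (deg-≥1 A v x x∈A a)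

  E-single : ∀ A x → (∀ y → y ∈ A → y ≡ x) → E A ≡ 0
  E-single A x only = sum-0 _ (λ v → outer v)
    where
    outer : ∀ v → 𝟙 (A v) * deg A v ≡ 0
    outer v with A v in eqv
    ... | false = refl
    ... | true = trans (+-identityʳ _) (sum-0 _ inner)
      where
      inner : ∀ u → 𝟙 (A u) * 𝟙 (adj v u) ≡ 0
      inner u with A u in equ
      ... | false = refl
      ... | true rewrite only v eqv | only u equ | irrefl G x = refl

  cut-cong : ∀ {A A′ B B′} → (∀ v → A v ≡ A′ v) → (∀ v → B v ≡ B′ v) → cut A B ≡ cut A′ B′
  cut-cong h k = sum-cong (λ v → cong₂ (λ a d → 𝟙 a * d) (h v)
    (sum-cong (λ u → cong (λ b → 𝟙 b * 𝟙 (adj v u)) (k u))))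

-- States, colours and good colourings.

-- X: deleted; P: unrestricted; F: in the forest; D: in the forest with no neighbour in the 2-independent set;
-- N: in the 2-independent set or as for D.
data State : Set where
  X P F N D : State

wt : State → ℕ
wt X = 0
wt P = 5
wt F = 4
wt N = 3
wt D = 2

live : State → Bool
live X = false
live _ = true

data Colour : Set where
  off inI inF : Colour

data _allows_ : State → Colour → Set where
  X-off : X allows off
  P-inI : P allows inI
  P-inF : P allows inF
  F-inF : F allows inF
  N-inI : N allows inI
  N-inF : N allows inF
  D-inF : D allows inF

data Closed : State → Set where
  N-closed : Closed N
  D-closed : Closed D

infix 4 _⊑_

-- Read "demands at least as much as": a colouring that is good for the smaller states is good for
-- the larger ones.
_⊑_ : State → State → Set
s ⊑ t = (∀ c → s allows c → t allows c) × (Closed t → Closed s)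

⊑-refl : ∀ {s} → s ⊑ s
⊑-refl = (λ _ p → p) , (λ p → p)

-- `forceF` adds membership in the forest, `forceN` adds closedness, `forceD` adds both; the weight
-- drops by at most 1, 2 and 3.
forceF forceN forceD : State → State
forceF P = F
forceF N = D
forceF s = s
forceN P = N
forceN F = D
forceN s = s
forceD X = X
forceD _ = D

forceF-⊑ : ∀ s → forceF s ⊑ s
forceF-⊑ X = ⊑-refl
forceF-⊑ P = (λ { _ F-inF → P-inF }) , λ ()
forceF-⊑ F = ⊑-refl
forceF-⊑ N = (λ { _ D-inF → N-inF }) , λ _ → D-closed
forceF-⊑ D = ⊑-refl

forceN-⊑ : ∀ s → forceN s ⊑ s
forceN-⊑ X = ⊑-refl
forceN-⊑ P = (λ { _ N-inI → P-inI ; _ N-inF → P-inF }) , λ ()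
forceN-⊑ F = (λ { _ D-inF → F-inF }) , λ ()
forceN-⊑ N = ⊑-refl
forceN-⊑ D = ⊑-refl

forceD-⊑ : ∀ s → forceD s ⊑ s
forceD-⊑ X = ⊑-refl
forceD-⊑ P = (λ { _ D-inF → P-inF }) , λ ()
forceD-⊑ F = (λ { _ D-inF → F-inF }) , λ ()
forceD-⊑ N = (λ { _ D-inF → N-inF }) , λ _ → D-closed
forceD-⊑ D = ⊑-refl

forceF-wt : ∀ s → wt s ≤ wt (forceF s) + 1
forceF-wt X = z≤n
forceF-wt P = ≤-refl
forceF-wt F = m≤m+n _ _
forceF-wt N = ≤-refl
forceF-wt D = m≤m+n _ _

forceN-wt : ∀ s → wt s ≤ wt (forceN s) + 2
forceN-wt X = z≤n
forceN-wt P = ≤-refl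
forceN-wt F = ≤-refl
forceN-wt N = m≤m+n _ _
forceN-wt D = m≤m+n _ _

forceD-wt : ∀ s → wt s ≤ wt (forceD s) + 3
forceD-wt X = z≤n
forceD-wt P = ≤-refl
forceD-wt F = m≤m+n _ _
forceD-wt N = m≤m+n _ _
forceD-wt D = m≤m+n _ _

live-wt : ∀ {s} → live s ≡ true → 2 ≤ wt s
live-wt {P} _ = s≤s (s≤s z≤n)
live-wt {F} _ = s≤s (s≤s z≤n)
live-wt {N} _ = s≤s (s≤s z≤n)
live-wt {D} _ = s≤s (s≤s z≤n)

forceF-live : ∀ s → live (forceF s) ≡ live s
forceF-live X = refl
forceF-live P = refl
forceF-live F = refl
forceF-live N = refl
forceF-live D = refl

forceN-live : ∀ s → live (forceN s) ≡ live s
forceN-live X = refl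
forceN-live P = refl
forceN-live F = refl
forceN-live N = refl
forceN-live D = refl

forceD-live : ∀ s → live (forceD s) ≡ live s
forceD-live X = refl
forceD-live P = refl
forceD-live F = refl
forceD-live N = refl
forceD-live D = refl

inF-live : ∀ {s c} → s allows c → c ≡ inF → live s ≡ true
inF-live P-inF refl = refl
inF-live F-inF refl = refl
inF-live N-inF refl = refl
inF-live D-inF refl = refl

inI-live : ∀ {s c} → s allows c → c ≡ inI → live s ≡ true
inI-live P-inI refl = refl
inI-live N-inI refl = refl

live-colour : ∀ {s c} → s allows c → live s ≡ true → c ≡ inI ⊎ c ≡ inF
live-colour P-inI _ = inj₁ refl
live-colour P-inF _ = inj₂ refl
live-colour F-inF _ = inj₂ refl
live-colour N-inI _ = inj₁ refl
live-colour N-inF _ = inj₂ refl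
live-colour D-inF _ = inj₂ refl

X-colour : ∀ {s c} → s allows c → s ≡ X → c ≡ off
X-colour X-off refl = refl

forceF-colour : ∀ s {c} → forceF s allows c → live s ≡ true → c ≡ inF
forceF-colour P F-inF _ = refl
forceF-colour F F-inF _ = refl
forceF-colour N D-inF _ = refl
forceF-colour D D-inF _ = refl

forceD-colour : ∀ s {c} → forceD s allows c → live s ≡ true → c ≡ inF
forceD-colour P D-inF _ = refl
forceD-colour F D-inF _ = refl
forceD-colour N D-inF _ = refl
forceD-colour D D-inF _ = refl

forceD-closed : ∀ s → live s ≡ true → Closed (forceD s)
forceD-closed P _ = D-closed
forceD-closed F _ = D-closed
forceD-closed N _ = D-closed
forceD-closed D _ = D-closed

-- The rooted form of "every nonempty subset has a vertex of degree at most 1" is what survives gluing forests together.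
Forest : ∀ {n} → Graph n → (Fin n → Colour) → Set
Forest {n} G c = ∀ (S : VSet n) (t : Fin n) → (∀ v → v ∈ S → c v ≡ inF) → ∀ x → x ∈ S → x ≢ t →
  ∃ λ v → v ∈ S × v ≢ t × (∀ y z → y ∈ S → z ∈ S → Adj G v y ≡ true → Adj G v z ≡ true → y ≡ z)

-- Conflicts at distance 2 are listed only with the middle vertex in the forest: `I-I` excludes a
-- middle vertex in I, and deleted vertices do not count yet.
record Good {n : ℕ} (G : Graph n) (st : Fin n → State) (c : Fin n → Colour) : Set where
  field
    compat : ∀ v → st v allows c v
    I-I    : ∀ u v → c u ≡ inI → c v ≡ inI → Adj G u v ≡ true → ⊥
    I-F-I  : ∀ w u v → c w ≡ inF → c u ≡ inI → c v ≡ inI → Adj G w u ≡ true → Adj G w v ≡ true → u ≡ v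
    closed : ∀ w u → Closed (st w) → c w ≡ inF → c u ≡ inI → Adj G w u ≡ true → ⊥
    forest : Forest G c
open Good public

Colourable : ∀ {n} → Graph n → (Fin n → State) → Set
Colourable G st = ∃ (Good G st)

_∈?_ : ∀ {n} (x : Fin n) (A : VSet n) → Dec (x ∈ A)
x ∈? A = A x Bool.≟ true

∉-intro : ∀ {n} {A : VSet n} {x} → ¬ (x ∈ A) → x ∉ A
∉-intro {A = A} {x} h with A x
... | true = ⊥-elim (h refl)
... | false = refl

_[_↦_] : ∀ {n} {B : Set} → (Fin n → B) → Fin n → B → Fin n → B
(f [ x ↦ b ]) v = if v == x then b else f v

↦-here : ∀ {n} {B : Set} (f : Fin n → B) x b → (f [ x ↦ b ]) x ≡ b
↦-here f x b rewrite ==-refl x = refl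

↦-there : ∀ {n} {B : Set} (f : Fin n → B) x b {v} → v ≢ x → (f [ x ↦ b ]) v ≡ f v
↦-there f x b v≢x rewrite ==-false v≢x = refl

inI≢inF : ∀ {c} → c ≡ inI → c ≡ inF → ⊥
inI≢inF refl ()

inI≢off : ∀ {c} → c ≡ inI → c ≡ off → ⊥
inI≢off refl ()

inF≢off : ∀ {c} → c ≡ inF → c ≡ off → ⊥
inF≢off refl ()

-- Extending a colouring by one vertex.

module _ {n : ℕ} (G : Graph n) where
  open Potential G

  -- Unless `x` is the root, `x` itself is the required vertex. If it is, `S` without `x` is rooted
  -- anew at the one forest neighbour `w` of `x`; a vertex found there differs from `w`, so it is
  -- not adjacent to `x` and keeps its degree when `x` returns.
  forest-leaf : ∀ {c} x → Forest G c →
    (∀ y z → c y ≡ inF → c z ≡ inF → adj x y ≡ true → adj x z ≡ true → y ≡ z) →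
    Forest G (c [ x ↦ inF ])
  forest-leaf {c} x old leaf S t S⊆F x₀ x₀∈S x₀≢t = go (x ∈? S) (x ≟ t)
    where
    colour : ∀ {v} → v ∈ S → v ≢ x → c v ≡ inF
    colour {v} v∈S v≢x = trans (sym (↦-there c x inF v≢x)) (S⊆F v v∈S)

    Goal : Set
    Goal = ∃ λ v → v ∈ S × v ≢ t × (∀ y z → y ∈ S → z ∈ S → adj v y ≡ true → adj v z ≡ true → y ≡ z)

    leafS : ∀ y z → y ∈ S → z ∈ S → adj x y ≡ true → adj x z ≡ true → y ≡ z
    leafS y z y∈S z∈S ay az =
      leaf y z (colour y∈S (adj-≢ ay ∘ sym)) (colour z∈S (adj-≢ az ∘ sym)) ay az

    attach : ∃ λ w → ∀ q → q ∈ S → adj x q ≡ true → q ≡ w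
    attach with any? (λ q → (q ∈? S) ×-dec (adj x q Bool.≟ true))
    ... | yes (w , w∈S , aw) = w , λ q q∈S aq → leafS q w q∈S w∈S aq aw
    -- `x` has no neighbour in `S`, so any vertex can serve as the new root.
    ... | no none = x , λ q q∈S aq → ⊥-elim (none (q , q∈S , aq))

    rooted : x ≡ t → Goal
    rooted x≡t with attach
    ... | w , only with any? (λ q → (q ∈? S) ×-dec (¬? (q ≟ x) ×-dec ¬? (q ≟ w)))
    ...   | yes (q , q∈S , q≢x , q≢w)
      with old (S ∖ x) w (λ v v∈ → let (v∈S , v≢x) = ∖-elim S v∈ in colour v∈S v≢x) q (∖-∈ S q∈S q≢x) q≢w
    ...     | v , v∈ , v≢w , uniq = v , v∈S , (λ v≡t → v≢x (trans v≡t (sym x≡t))) ,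
      λ y z y∈S z∈S ay az → uniq y z (∖-∈ S y∈S (≢x ay)) (∖-∈ S z∈S (≢x az)) ay az
      where
      v∈S = proj₁ (∖-elim S {x} {v} v∈)
      v≢x = proj₂ (∖-elim S {x} {v} v∈)
      ≢x : ∀ {y} → adj v y ≡ true → y ≢ x
      ≢x a refl = v≢w (only v v∈S (adj-sym a))
    -- `S` has no vertices besides `x` and `w`, so `x₀` is `w` and can only be adjacent to `x`.
    rooted x≡t | w , only | no none = x₀ , x₀∈S , x₀≢t ,
      λ y z y∈S z∈S ay az → trans (≡x y∈S ay) (sym (≡x z∈S az))
      where
      ≡w : ∀ {q} → q ∈ S → q ≢ x → q ≡ w
      ≡w {q} q∈S q≢x with q ≟ w
      ... | yes p = p
      ... | no q≢w = ⊥-elim (none (q , q∈S , q≢x , q≢w))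
      ≡x : ∀ {y} → y ∈ S → adj x₀ y ≡ true → y ≡ x
      ≡x {y} y∈S a with y ≟ x
      ... | yes p = p
      ... | no y≢x = ⊥-elim (adj-≢ a (trans (≡w x₀∈S (λ p → x₀≢t (trans p x≡t))) (sym (≡w y∈S y≢x))))

    go : Dec (x ∈ S) → Dec (x ≡ t) → Goal
    go (no x∉S) _ = old S t (λ v v∈S → colour v∈S (λ { refl → x∉S v∈S })) x₀ x₀∈S x₀≢t
    go (yes x∈S) (no x≢t) = x , x∈S , x≢t , leafS
    go (yes x∈S) (yes x≡t) = rooted x≡t

  -- How the reductions restore a deleted vertex: `c` was found for more demanding states, and the
  -- last three hypotheses list what colouring `x` could break, namely the forest, `I-F-I` at `x`
  -- and `closed` at `x`.
  add-inF : ∀ {st₁ st₂ c} x → Good G st₁ c → (∀ v → v ≢ x → st₁ v ⊑ st₂ v) → st₂ x allows inF →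
    (∀ y z → c y ≡ inF → c z ≡ inF → adj x y ≡ true → adj x z ≡ true → y ≡ z) →
    (∀ y z → c y ≡ inI → c z ≡ inI → adj x y ≡ true → adj x z ≡ true → y ≡ z) →
    (Closed (st₂ x) → ∀ y → c y ≡ inI → adj x y ≡ true → ⊥) →
    Good G st₂ (c [ x ↦ inF ])
  add-inF {st₁} {st₂} {c} x g rel allow leaf oneI noI = record
    { compat = compat′
    ; I-I = λ u v cu cv → I-I g u v (old-I u cu) (old-I v cv)
    ; I-F-I = I-F-I′
    ; closed = closed′
    ; forest = forest-leaf x (forest g) leaf
    }
    where
    c′ = c [ x ↦ inF ]
    compat′ : ∀ v → st₂ v allows c′ v
    compat′ v with v ≟ x
    ... | yes refl = allow
    ... | no v≢x = proj₁ (rel v v≢x) (c v) (compat g v)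
    old-I : ∀ v → c′ v ≡ inI → c v ≡ inI
    old-I v p with v ≟ x
    old-I v () | yes _
    old-I v p  | no _ = p
    I-F-I′ : ∀ w u v → c′ w ≡ inF → c′ u ≡ inI → c′ v ≡ inI → adj w u ≡ true → adj w v ≡ true → u ≡ v
    I-F-I′ w u v cw cu cv with w ≟ x
    ... | yes refl = oneI u v (old-I u cu) (old-I v cv)
    ... | no _ = I-F-I g w u v cw (old-I u cu) (old-I v cv)
    closed′ : ∀ w u → Closed (st₂ w) → c′ w ≡ inF → c′ u ≡ inI → adj w u ≡ true → ⊥
    closed′ w u cl cw cu with w ≟ x
    ... | yes refl = noI cl u (old-I u cu)
    ... | no w≢x = closed g w u (proj₂ (rel w w≢x) cl) cw (old-I u cu)

  -- The forest stays as it is. A forest neighbour of `x` must be open and have seen nothing of I so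
  -- far, because `x` becomes its one neighbour in I.
  add-inI : ∀ {st₁ st₂ c} x → Good G st₁ c → c x ≡ off → (∀ v → v ≢ x → st₁ v ⊑ st₂ v) → st₂ x allows inI →
    (∀ y → c y ≡ inI → adj x y ≡ true → ⊥) →
    (∀ w → c w ≡ inF → adj x w ≡ true → ¬ Closed (st₂ w) × (∀ u → c u ≡ inI → adj w u ≡ true → ⊥)) →
    Good G st₂ (c [ x ↦ inI ])
  add-inI {st₁} {st₂} {c} x g cx rel allow noI free = record
    { compat = compat′ ; I-I = I-I′ ; I-F-I = I-F-I′ ; closed = closed′
    ; forest = λ S t S⊆F → forest g S t (λ v v∈S → old-F v (S⊆F v v∈S))
    }
    where
    c′ = c [ x ↦ inI ]
    compat′ : ∀ v → st₂ v allows c′ v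
    compat′ v with v ≟ x
    ... | yes refl = allow
    ... | no v≢x = proj₁ (rel v v≢x) (c v) (compat g v)
    old-F : ∀ v → c′ v ≡ inF → c v ≡ inF
    old-F v p with v ≟ x
    old-F v () | yes _
    old-F v p  | no _ = p
    I-I′ : ∀ u v → c′ u ≡ inI → c′ v ≡ inI → adj u v ≡ true → ⊥
    I-I′ u v cu cv a with u ≟ x | v ≟ x
    ... | yes refl | yes refl = adj-≢ a refl
    ... | yes refl | no _ = noI v cv a
    ... | no _ | yes refl = noI u cu (adj-sym a)
    ... | no _ | no _ = I-I g u v cu cv a
    I-F-I′ : ∀ w u v → c′ w ≡ inF → c′ u ≡ inI → c′ v ≡ inI → adj w u ≡ true → adj w v ≡ true → u ≡ v
    I-F-I′ w u v cw cu cv au av with u ≟ x | v ≟ x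
    ... | yes refl | yes refl = refl
    ... | yes refl | no _ = ⊥-elim (proj₂ (free w (old-F w cw) (adj-sym au)) v cv av)
    ... | no _ | yes refl = ⊥-elim (proj₂ (free w (old-F w cw) (adj-sym av)) u cu au)
    ... | no _ | no _ = I-F-I g w u v (old-F w cw) cu cv au av
    closed′ : ∀ w u → Closed (st₂ w) → c′ w ≡ inF → c′ u ≡ inI → adj w u ≡ true → ⊥
    closed′ w u cl cw cu a with u ≟ x
    ... | yes refl = proj₁ (free w (old-F w cw) (adj-sym a)) cl
    ... | no _ = closed g w u (proj₂ (rel w w≢x) cl) (old-F w cw) cu a
      where
      w≢x : w ≢ x
      w≢x refl = inF≢off (old-F w cw) cx

-- Weights and potentials under a change of state.

W : ∀ {n} → (Fin n → State) → VSet n → ℕ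
W st A = sumFin (λ v → 𝟙 (A v) * wt (st v))

-- Positive potential: `E` already counts every edge twice, so `2 * E` is the cost 4 per edge.
Sparse : ∀ {n} → Graph n → (Fin n → State) → Set
Sparse G st = ∀ A → A ⊆ live ∘ st → ∀ x → x ∈ A → 2 * Potential.E G A + 1 ≤ W st A

W-▷ : ∀ {n} (st : Fin n → State) x A → x ∉ A → W st (x ▷ A) ≡ wt (st x) + W st A
W-▷ st x A x∉A = sum-▷ x A x∉A (wt ∘ st)

W-cost : ∀ {n} (st st′ : Fin n → State) A (cost : Fin n → ℕ) →
  (∀ v → v ∈ A → wt (st v) ≤ wt (st′ v) + cost v) → W st A ≤ W st′ A + sumFin (λ v → 𝟙 (A v) * cost v)
W-cost st st′ A cost h = ≤-trans (sum-mono term) (≤-reflexive (sum-+ (λ v → 𝟙 (A v) * wt (st′ v)) (λ v → 𝟙 (A v) * cost v)))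
  where
  term : ∀ v → 𝟙 (A v) * wt (st v) ≤ 𝟙 (A v) * wt (st′ v) + 𝟙 (A v) * cost v
  term v with A v in eq
  ... | false = z≤n
  ... | true rewrite +-identityʳ (wt (st v)) | +-identityʳ (wt (st′ v)) | +-identityʳ (cost v) = h v eq

W-update : ∀ {n} (st : Fin n → State) A u s k → wt (st u) ≤ wt s + k →
  W st A ≤ W (st [ u ↦ s ]) A + k * 𝟙 (A u)
W-update st A u s k h = ≤-trans (W-cost st (st [ u ↦ s ]) A (λ v → 𝟙 (v == u) * k) term)
  (≤-reflexive (cong (W (st [ u ↦ s ]) A +_)
    (trans (sum-cong (λ v → rearrange (𝟙 (A v)) (𝟙 (v == u)))) (sum-δ u (λ v → k * 𝟙 (A v))))))
  where
  rearrange : ∀ a b → a * (b * k) ≡ b * (k * a)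
  rearrange a b = solve (a ∷ b ∷ k ∷ [])
  term : ∀ v → v ∈ A → wt (st v) ≤ wt ((st [ u ↦ s ]) v) + 𝟙 (v == u) * k
  term v _ with v ≟ u
  ... | yes refl rewrite +-identityʳ k = h
  ... | no _ = m≤m+n _ _

W-outside : ∀ {n} (st : Fin n → State) A x s → x ∉ A → W st A ≤ W (st [ x ↦ s ]) A
W-outside st A x s x∉A = ≤-trans (W-update st A x s (wt (st x)) (m≤n+m _ _))
  (≤-reflexive (trans (cong (λ b → W (st [ x ↦ s ]) A + wt (st x) * 𝟙 b) x∉A)
    (trans (cong (W (st [ x ↦ s ]) A +_) (*-zeroʳ (wt (st x)))) (+-identityʳ _))))

W-single : ∀ {n} (st : Fin n → State) A x → x ∈ A → live (st x) ≡ true → 2 ≤ W st A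
W-single st A x x∈A l = ≤-trans (live-wt l)
  (subst (_≤ W st A) (∈⇒1* (wt (st x)) x∈A) (term≤sum (λ v → 𝟙 (A v) * wt (st v)) x))

update-⊑ : ∀ {n} (st : Fin n → State) u s → s ⊑ st u → ∀ v → (st [ u ↦ s ]) v ⊑ st v
update-⊑ st u s h v with v ≟ u
... | yes refl = h
... | no _ = ⊑-refl

⊑-trans : ∀ {r s t} → r ⊑ s → s ⊑ t → r ⊑ t
⊑-trans (p , q) (p′ , q′) = (λ c → p′ c ∘ p c) , (q ∘ q′)

kill : ∀ {n} → (Fin n → State) → Fin n → Fin n → State
kill st x = st [ x ↦ X ]

kill-live : ∀ {n} (st : Fin n → State) x v → live (kill st x v) ≡ true → live (st v) ≡ true × v ≢ x
kill-live st x v l with v ≟ x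
kill-live st x v () | yes _
kill-live st x v l  | no v≢x = l , v≢x

kill-dead : ∀ {n} (st : Fin n → State) x v → live (st v) ≡ false → live (kill st x v) ≡ false
kill-dead st x v d with v ≟ x
... | yes _ = refl
... | no _ = d

killed : ∀ {n} (st : Fin n → State) x → live (kill st x x) ≡ false
killed st x rewrite ==-refl x = refl

setF : ∀ {n} → (Fin n → State) → Fin n → Fin n → State
setF st u = st [ u ↦ forceF (st u) ]

setF-⊑ : ∀ {n} (st : Fin n → State) u v → setF st u v ⊑ st v
setF-⊑ st u = update-⊑ st u _ (forceF-⊑ (st u))

setF-live : ∀ {n} (st : Fin n → State) u v → live (setF st u v) ≡ live (st v)
setF-live st u v with v ≟ u
... | yes refl = forceF-live (st v)
... | no _ = refl

setF-W : ∀ {n} (st : Fin n → State) A u → W st A ≤ W (setF st u) A + 1 * 𝟙 (A u)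
setF-W st A u = W-update st A u _ 1 (forceF-wt (st u))

setF-colour : ∀ {n} (st : Fin n → State) u {c} → setF st u u allows c → live (st u) ≡ true → c ≡ inF
setF-colour st u p l rewrite ==-refl u = forceF-colour (st u) p l

data Open : State → Set where
  P-open : Open P
  F-open : Open F

Open-inF : ∀ {s} → Open s → s allows inF
Open-inF P-open = P-inF
Open-inF F-open = F-inF

Open-¬Closed : ∀ {s} → Open s → ¬ Closed s
Open-¬Closed P-open ()
Open-¬Closed F-open ()

Open-forceN : ∀ {s} → Open s → Closed (forceN s)
Open-forceN P-open = N-closed
Open-forceN F-open = D-closed

wt≥4⇒Open : ∀ s → 4 ≤ wt s → Open s
wt≥4⇒Open P _ = P-open
wt≥4⇒Open F _ = F-open
wt≥4⇒Open N (s≤s (s≤s (s≤s ())))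
wt≥4⇒Open D (s≤s (s≤s ()))

dead-∉ : ∀ {n} (st : Fin n → State) A x → A ⊆ live ∘ st → live (st x) ≡ false → x ∉ A
dead-∉ st A x A⊆ d = ∉-intro {A = A} {x} (λ x∈A → true≢false (A⊆ x x∈A) d)

kill-⊑ : ∀ {n} (st : Fin n → State) x z → z ≢ x → kill st x z ⊑ st z
kill-⊑ st x z z≢x rewrite ==-false z≢x = ⊑-refl

kill-mono : ∀ {n} {st st′ : Fin n → State} → (∀ z → st z ⊑ st′ z) → ∀ x z → kill st x z ⊑ kill st′ x z
kill-mono h x z with z ≟ x
... | yes _ = ⊑-refl
... | no _ = h z

P-¬Closed : ∀ {s} → s ≡ P → ¬ Closed s
P-¬Closed refl ()

∅ : ∀ {n} → VSet n
∅ _ = false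

-- Reducible configurations.

module Reductions {n : ℕ} (G : Graph n) (st : Fin n → State) (sparse : Sparse G st)
  (gap : ∀ A → A ⊆ live ∘ st → ∀ p q r → p ≢ q → p ∈ A → q ∈ A → live (st r) ≡ true → r ∉ A →
    2 * Potential.E G A + 3 ≤ W st A)
  (smaller : ∀ st′ → (live ∘ st′) ⊆ (live ∘ st) → ∀ r → live (st r) ≡ true → live (st′ r) ≡ false →
    Sparse G st′ → Colourable G st′)
  where
  open Potential G

  V : VSet n
  V = live ∘ st

  -- A set with two vertices misses the deleted `r`, so `gap` gives it potential 3 and the new
  -- states may cost it 2. A single live vertex spans no edge and weighs at least 2.
  colour-smaller : ∀ st′ → (live ∘ st′) ⊆ V → ∀ r → r ∈ V → live (st′ r) ≡ false →
    (∀ A → A ⊆ live ∘ st′ → 2 * E A + 3 ≤ W st A → (∀ p q → p ∈ A → q ∈ A → p ≢ q → 2 * E A + 1 ≤ W st′ A)) →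
    Colourable G st′
  colour-smaller st′ sub r r∈V dead h = smaller st′ sub r r∈V dead sparse′
    where
    sparse′ : Sparse G st′
    sparse′ A A⊆ x x∈A with any? (λ q → (q ∈? A) ×-dec ¬? (q ≟ x))
    ... | yes (q , q∈A , q≢x) = h A A⊆
      (gap A (λ v → sub v ∘ A⊆ v) q x r q≢x q∈A x∈A r∈V (dead-∉ st′ A r A⊆ dead)) q x q∈A x∈A q≢x
    ... | no none = subst (λ e → 2 * e + 1 ≤ W st′ A) (sym (E-single A x only))
      (≤-trans (s≤s z≤n) (W-single st′ A x x∈A (A⊆ x x∈A)))
      where
      only : ∀ q → q ∈ A → q ≡ x
      only q q∈A with q ≟ x
      ... | yes p = p
      ... | no q≢x = ⊥-elim (none (q , q∈A , q≢x))

  -- The set of `p` and `q` spans an edge of cost 4 and misses `r`, so `gap` asks for weight 4 + 3.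
  pair-gap : ∀ p q r → p ∈ V → q ∈ V → r ∈ V → r ≢ p → r ≢ q → adj p q ≡ true → 7 ≤ wt (st p) + wt (st q)
  pair-gap p q r p∈V q∈V r∈V r≢p r≢q a = subst (7 ≤_) W≡ (≤-trans E≥ (gap A A⊆V p q r p≢q p∈A q∈A r∈V r∉A))
    where
    p≢q = adj-≢ a
    A = p ▷ q ▷ ∅
    p∉q : p ∉ q ▷ ∅
    p∉q = ▷-∉ q ∅ p p≢q refl
    p∈A = ▷-here p (q ▷ ∅)
    q∈A = ▷-there p (q ▷ ∅) q (▷-here q ∅)
    r∉A = ▷-∉ p (q ▷ ∅) r r≢p (▷-∉ q ∅ r r≢q refl)
    A⊆V : A ⊆ V
    A⊆V = ▷-⊆ p (q ▷ ∅) V p∈V (▷-⊆ q ∅ V q∈V (λ _ ()))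
    W≡ : W st A ≡ wt (st p) + wt (st q)
    W≡ = trans (W-▷ st p (q ▷ ∅) p∉q) (cong (wt (st p) +_) (trans (W-▷ st q ∅ refl)
      (trans (cong (wt (st q) +_) (sum-0 {n} (λ _ → 0) (λ _ → refl))) (+-identityʳ _))))
    E≥ : 7 ≤ 2 * E A + 3
    E≥ rewrite E-▷ p (q ▷ ∅) p∉q with deg (q ▷ ∅) p | deg-≥1 (q ▷ ∅) p q (▷-here q ∅) a
    ... | d | d≥1 = bound (E (q ▷ ∅)) d d≥1
      where
      bound : ∀ e d → 1 ≤ d → 7 ≤ 2 * (e + 2 * d) + 3
      bound e d h = linear (2 * e) (scale 4 h) (solve (e ∷ d ∷ []))

  -- Forcing `u` into the forest costs at most 1 and makes the colour `inF` safe for `x` even in a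
  -- closed state.
  reduce-leaf : ∀ x u → x ∈ V → (∀ y → y ∈ V → adj x y ≡ true → y ≡ u) → Colourable G st
  reduce-leaf x u x∈V only = result (colour-smaller st′ sub x x∈V (killed (setF st u) x) sparse′)
    where
    st′ = kill (setF st u) x
    sub : (live ∘ st′) ⊆ V
    sub v l = trans (sym (setF-live st u v)) (proj₁ (kill-live (setF st u) x v l))
    sparse′ : ∀ A → A ⊆ live ∘ st′ → 2 * E A + 3 ≤ W st A → (∀ p q → p ∈ A → q ∈ A → p ≢ q → 2 * E A + 1 ≤ W st′ A)
    sparse′ A A⊆ h _ _ _ _ _ = bound (E A) (W st A) (W (setF st u) A) (W st′ A) (𝟙 (A u)) h (setF-W st A u)
      (W-outside (setF st u) A x X (dead-∉ st′ A x A⊆ (killed (setF st u) x))) (𝟙≤1 (A u))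
      where
      bound : ∀ e w w₁ w₂ i → 2 * e + 3 ≤ w → w ≤ w₁ + 1 * i → w₁ ≤ w₂ → i ≤ 1 → 2 * e + 1 ≤ w₂
      bound e w w₁ w₂ i p q r s = linear 1 (+-mono-≤ (+-mono-≤ p q) (+-mono-≤ r s)) (solve (e ∷ w ∷ w₁ ∷ w₂ ∷ i ∷ []))
    result : Colourable G st′ → Colourable G st
    result (c , g) = c [ x ↦ inF ] , add-inF G x g rel (allowsF (st x) x∈V)
        (λ y z cy cz ay az → trans (near y (inF-live (compat g y) cy) ay) (sym (near z (inF-live (compat g z) cz) az)))
        (λ y z cy cz ay az → ⊥-elim (noI y cy ay)) (λ _ → noI)
      where
      allowsF : ∀ s → live s ≡ true → s allows inF
      allowsF P _ = P-inF
      allowsF F _ = F-inF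
      allowsF N _ = N-inF
      allowsF D _ = D-inF
      rel : ∀ v → v ≢ x → st′ v ⊑ st v
      rel v v≢x rewrite ==-false v≢x = setF-⊑ st u v
      near : ∀ y → live (st′ y) ≡ true → adj x y ≡ true → y ≡ u
      near y l a = only y (sub y l) a
      noI : ∀ y → c y ≡ inI → adj x y ≡ true → ⊥
      noI y cy a with near y (inI-live (compat g y) cy) a
      ... | refl = inI≢inF cy (setF-colour st y
        (subst (_allows c y) (↦-there (setF st y) x X (adj-≢ a ∘ sym)) (compat g y))
        (sub y (inI-live (compat g y) cy)))

  record Nbrs₂ (v x y : Fin n) : Set where
    field
      distinct : x ≢ y
      live₁ : x ∈ V
      live₂ : y ∈ V
      adj₁ : adj v x ≡ true
      adj₂ : adj v y ≡ true
      cover : ∀ z → z ∈ V → adj v z ≡ true → z ≡ x ⊎ z ≡ y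
  open Nbrs₂ public

  -- Closing `v` costs at most 2, all that the gap leaves. It serves the case in which `u` and `v`
  -- both come out `inF`: putting `a` and `b` into the forest could then close a cycle, so `b` goes
  -- to I, which requires that `v` have no other neighbour in I. If `u` or `v` lies in I, no path
  -- through `a` and `b` joins two forest vertices, and both become `inF`.
  reduce-thread : ∀ a b u v → st b ≡ P → Open (st a) → Open (st v) → b ∈ V →
    Nbrs₂ b a v → Nbrs₂ a b u → Colourable G st
  reduce-thread a b u v stb oa ov b∈V nb na = result (colour-smaller st′ sub a a∈V (killed st₁ a) sparse′)
    where
    a∈V = live₁ nb
    st₀ = st [ v ↦ forceN (st v) ]
    st₁ = kill st₀ b
    st′ = kill st₁ a
    st₀-live : ∀ z → live (st₀ z) ≡ live (st z)
    st₀-live z with z ≟ v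
    ... | yes refl = forceN-live (st z)
    ... | no _ = refl
    b-dead : live (st′ b) ≡ false
    b-dead = kill-dead st₁ a b (killed st₀ b)
    a≢b : a ≢ b
    a≢b = adj-≢ (adj₁ na)
    v≢a : v ≢ a
    v≢a = distinct nb ∘ sym
    v≢b : v ≢ b
    v≢b = adj-≢ (adj₂ nb) ∘ sym
    u≢a : u ≢ a
    u≢a = adj-≢ (adj₂ na) ∘ sym
    u≢b : u ≢ b
    u≢b = distinct na ∘ sym
    sub : (live ∘ st′) ⊆ V
    sub z l = trans (sym (st₀-live z)) (proj₁ (kill-live st₀ b z (proj₁ (kill-live st₁ a z l))))
    sparse′ : ∀ A → A ⊆ live ∘ st′ → 2 * E A + 3 ≤ W st A → (∀ p q → p ∈ A → q ∈ A → p ≢ q → 2 * E A + 1 ≤ W st′ A)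
    sparse′ A A⊆ h _ _ _ _ _ = bound (E A) (W st A) (W st₀ A) (W st₁ A) (W st′ A) (𝟙 (A v)) h
      (W-update st A v _ 2 (forceN-wt (st v)))
      (W-outside st₀ A b X (dead-∉ st′ A b A⊆ b-dead))
      (W-outside st₁ A a X (dead-∉ st′ A a A⊆ (killed st₁ a))) (𝟙≤1 (A v))
      where
      bound : ∀ e w w₀ w₁ w₂ i → 2 * e + 3 ≤ w → w ≤ w₀ + 2 * i → w₀ ≤ w₁ → w₁ ≤ w₂ → i ≤ 1 → 2 * e + 1 ≤ w₂
      bound e w w₀ w₁ w₂ i p q r s t = linear 0 (+-mono-≤ (+-mono-≤ p q) (+-mono-≤ (+-mono-≤ r s) (scale 2 t)))
        (solve (e ∷ w ∷ w₀ ∷ w₁ ∷ w₂ ∷ i ∷ []))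
    result : Colourable G st′ → Colourable G st
    result (c , g) = by-v (live-colour (compat g v) v-live)
      where
      st′-off : ∀ z → z ≢ a → z ≢ b → st′ z ≡ st₀ z
      st′-off z z≢a z≢b = trans (↦-there st₁ a X z≢a) (↦-there st₀ b X z≢b)
      st₀-⊑ : ∀ z → st₀ z ⊑ st z
      st₀-⊑ = update-⊑ st v _ (forceN-⊑ (st v))
      v-live : live (st′ v) ≡ true
      v-live = trans (cong live (st′-off v v≢a v≢b)) (trans (st₀-live v) (live₂ nb))
      u-live : live (st′ u) ≡ true
      u-live = trans (cong live (st′-off u u≢a u≢b)) (trans (st₀-live u) (live₂ na))
      rel-b : ∀ z → z ≢ a → st′ z ⊑ kill st b z
      rel-b z z≢a rewrite ==-false z≢a with z ≟ b
      ... | yes _ = ⊑-refl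
      ... | no _ = st₀-⊑ z
      rel-a : ∀ z → z ≢ b → st′ z ⊑ kill st a z
      rel-a z z≢b rewrite ==-false z≢b with z ≟ a
      ... | yes _ = ⊑-refl
      ... | no _ = st₀-⊑ z
      from-a : ∀ z → live (st′ z) ≡ true → adj a z ≡ true → z ≡ u
      from-a z l az with cover na z (sub z l) az
      ... | inj₂ p = p
      ... | inj₁ refl = ⊥-elim (true≢false l b-dead)
      from-b : ∀ z → live (st′ z) ≡ true → adj b z ≡ true → z ≡ v
      from-b z l bz with cover nb z (sub z l) bz
      ... | inj₂ p = p
      ... | inj₁ refl = ⊥-elim (true≢false l (killed st₁ z))
      coloured : ∀ {d} z → d ≢ off → c z ≡ d → live (st′ z) ≡ true
      coloured {off} z d≢off _ = ⊥-elim (d≢off refl)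
      coloured {inI} z _ cz = inI-live (compat g z) cz
      coloured {inF} z _ cz = inF-live (compat g z) cz

      Sees : Fin n → Fin n → Set
      Sees x k = ∀ z → live (st′ z) ≡ true → adj x z ≡ true → z ≡ k

      unique : ∀ {x k d} → d ≢ off → Sees x k → ∀ y z → c y ≡ d → c z ≡ d → adj x y ≡ true → adj x z ≡ true → y ≡ z
      unique d≢off h y z cy cz ay az = trans (h y (coloured y d≢off cy) ay) (sym (h z (coloured z d≢off cz) az))

      only-new : ∀ {x k d} y col → d ≢ off → Sees x k → c k ≢ d →
        ∀ z w → (c [ y ↦ col ]) z ≡ d → (c [ y ↦ col ]) w ≡ d → adj x z ≡ true → adj x w ≡ true → z ≡ w
      only-new {x} {k} {d} y col d≢off h ck≢d z w cz cw az aw = trans (new z cz az) (sym (new w cw aw))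
        where
        new : ∀ z → (c [ y ↦ col ]) z ≡ d → adj x z ≡ true → z ≡ y
        new z cz az with z ≟ y
        ... | yes p = p
        ... | no _ = ⊥-elim (ck≢d (trans (cong c (sym (h z (coloured z d≢off cz) az))) cz))

      only-old : ∀ {x k d} y col → d ≢ off → Sees x k → col ≢ d →
        ∀ z w → (c [ y ↦ col ]) z ≡ d → (c [ y ↦ col ]) w ≡ d → adj x z ≡ true → adj x w ≡ true → z ≡ w
      only-old {x} {k} {d} y col d≢off h col≢d z w cz cw az aw = trans (old z cz az) (sym (old w cw aw))
        where
        old : ∀ z → (c [ y ↦ col ]) z ≡ d → adj x z ≡ true → z ≡ k
        old z cz az with z ≟ y
        ... | yes _ = ⊥-elim (col≢d cz)
        ... | no _ = h z (coloured z d≢off cz) az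

      a-allows : kill st b a allows inF
      a-allows rewrite ==-false a≢b = Open-inF oa
      a-open : Closed (kill st b a) → ⊥
      a-open cl rewrite ==-false a≢b = Open-¬Closed oa cl
      b≢a : b ≢ a
      b≢a = a≢b ∘ sym
      at-b : kill st a b ≡ P
      at-b = trans (↦-there st a X b≢a) stb

      by-u : c v ≡ inF → c u ≡ inI ⊎ c u ≡ inF → Colourable G st
      by-u cv (inj₁ cu) = _ , add-inF G a g₁ (kill-⊑ st a) (Open-inF oa)
          (only-new b inF (λ ()) from-a (inI≢inF cu)) (only-old b inF (λ ()) from-a (λ ())) (⊥-elim ∘ Open-¬Closed oa)
        where
        g₁ : Good G (kill st a) (c [ b ↦ inF ])
        g₁ = add-inF G b g rel-a (subst (_allows inF) (sym at-b) P-inF)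
          (unique (λ ()) from-b) (unique (λ ()) from-b) (⊥-elim ∘ P-¬Closed at-b)
      by-u cv (inj₂ cu) = _ , add-inF G a g₁ (kill-⊑ st a) (Open-inF oa)
          (only-old b inI (λ ()) from-a (λ ())) (only-new b inI (λ ()) from-a (λ p → inI≢inF p cu)) (⊥-elim ∘ Open-¬Closed oa)
        where
        v-closed : Closed (st′ v)
        v-closed = subst Closed (sym (trans (st′-off v v≢a v≢b) (↦-here st v _))) (Open-forceN ov)
        free : ∀ w → c w ≡ inF → adj b w ≡ true → ¬ Closed (kill st a w) × (∀ y → c y ≡ inI → adj w y ≡ true → ⊥)
        free w cw bw with from-b w (inF-live (compat g w) cw) bw
        ... | refl = (λ cl → Open-¬Closed ov (subst Closed (↦-there st a X v≢a) cl)) , λ y → closed g w y v-closed cw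
        g₁ : Good G (kill st a) (c [ b ↦ inI ])
        g₁ = add-inI G b g (X-colour (compat g b) st′b) rel-a (subst (_allows inI) (sym at-b) P-inI)
          (λ y cy by → inI≢inF cy (trans (cong c (from-b y (inI-live (compat g y) cy) by)) cv)) free
          where
          st′b : st′ b ≡ X
          st′b = trans (↦-there st₁ a X b≢a) (↦-here st₀ b X)

      by-v : c v ≡ inI ⊎ c v ≡ inF → Colourable G st
      -- The order matters: `b`, added last, sees only `a` in the forest, whereas `a` added last
      -- might see both `b` and `u`.
      by-v (inj₁ cv) = _ , add-inF G b g₁ (kill-⊑ st b) (subst (_allows inF) (sym stb) P-inF)
          (only-new a inF (λ ()) from-b (inI≢inF cv)) (only-old a inF (λ ()) from-b (λ ())) (⊥-elim ∘ P-¬Closed stb)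
        where
        g₁ : Good G (kill st b) (c [ a ↦ inF ])
        g₁ = add-inF G a g rel-b a-allows (unique (λ ()) from-a) (unique (λ ()) from-a) (⊥-elim ∘ a-open)
      by-v (inj₂ cv) = by-u cv (live-colour (compat g u) u-live)

  -- `p` hangs off `x` as a leaf of the forest and has `v` as its one neighbour in I.
  add-pendant : ∀ {st₁ st₂ c p v x} → Nbrs₂ p v x → Good G st₁ c → (live ∘ st₁) ⊆ V → (∀ z → z ≢ p → st₁ z ⊑ st₂ z) →
    st₂ p ≡ P → c v ≡ inI → c x ≡ inF → Good G st₂ (c [ p ↦ inF ])
  add-pendant {c = c} {p} {v} {x} np g sub rel stp cv cx = add-inF G p g rel (subst (_allows inF) (sym stp) P-inF)
      (λ y z cy cz ay az → trans (F-nbr y cy ay) (sym (F-nbr z cz az)))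
      (λ y z cy cz ay az → trans (I-nbr y cy ay) (sym (I-nbr z cz az)))
      (⊥-elim ∘ P-¬Closed stp)
    where
    F-nbr : ∀ z → c z ≡ inF → adj p z ≡ true → z ≡ x
    F-nbr z cz a with cover np z (sub z (inF-live (compat g z) cz)) a
    ... | inj₁ refl = ⊥-elim (inI≢inF cv cz)
    ... | inj₂ e = e
    I-nbr : ∀ z → c z ≡ inI → adj p z ≡ true → z ≡ v
    I-nbr z cz a with cover np z (sub z (inI-live (compat g z) cz)) a
    ... | inj₁ e = e
    ... | inj₂ refl = ⊥-elim (inI≢inF cz cx)

  -- `n₀` is to enter I, with `x` a leaf hanging off `y`. The other neighbours of `n₀` are forced to
  -- D at cost 3 each; the 4 per edge at `n₀` pays for them after `A` is enlarged by `n₀`, and also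
  -- by `x` when `y` lies in `A`.
  reduce-N : ∀ n₀ x y → st n₀ ≡ N → st x ≡ P → n₀ ∈ V → x ∈ V → Nbrs₂ x n₀ y → Colourable G st
  reduce-N n₀ x y stn stx n∈V x∈V nx = result (colour-smaller st′ sub x x∈V (killed st₁ x) sparse′)
    where
    st₀ : Fin n → State
    -- Adjacency to `n₀` is tested first: if `y` is itself a neighbour of `n₀`, then `forceD`
    -- already puts it into the forest.
    st₀ z = if adj n₀ z then forceD (st z) else setF st y z
    st₁ = kill st₀ n₀
    st′ = kill st₁ x
    st₀-live : ∀ z → live (st₀ z) ≡ live (st z)
    st₀-live z with adj n₀ z
    ... | true = forceD-live (st z)
    ... | false = setF-live st y z
    sub : (live ∘ st′) ⊆ V
    sub z l = trans (sym (st₀-live z)) (proj₁ (kill-live st₀ n₀ z (proj₁ (kill-live st₁ x z l))))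
    n-dead : live (st′ n₀) ≡ false
    n-dead = kill-dead st₁ x n₀ (killed st₀ n₀)
    n≢x : n₀ ≢ x
    n≢x = adj-≢ (adj₁ nx) ∘ sym
    y≢x : y ≢ x
    y≢x = adj-≢ (adj₂ nx) ∘ sym
    y≢n : y ≢ n₀
    y≢n = distinct nx ∘ sym
    sparse′ : ∀ A → A ⊆ live ∘ st′ → 2 * E A + 3 ≤ W st A → (∀ p q → p ∈ A → q ∈ A → p ≢ q → 2 * E A + 1 ≤ W st′ A)
    sparse′ A A⊆ h p q p∈A q∈A p≢q = cases (deg A n₀) refl (A y) refl
      where
      A⊆V : A ⊆ V
      A⊆V z = sub z ∘ A⊆ z
      n∉A = dead-∉ st′ A n₀ A⊆ n-dead
      x∉A = dead-∉ st′ A x A⊆ (killed st₁ x)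
      An = n₀ ▷ A
      x∉An : x ∉ An
      x∉An = ▷-∉ n₀ A x (n≢x ∘ sym) x∉A
      An⊆V = ▷-⊆ n₀ A V n∈V A⊆V
      cost : Fin n → ℕ
      cost z = 3 * 𝟙 (adj n₀ z) + 𝟙 (z == y)
      cost-bound : ∀ z → wt (st z) ≤ wt (st₀ z) + cost z
      cost-bound z with adj n₀ z
      ... | true = ≤-trans (forceD-wt (st z)) (+-monoʳ-≤ (wt (forceD (st z))) (m≤m+n 3 _))
      ... | false with z ≟ y
      ...   | yes refl = forceF-wt (st z)
      ...   | no _ = m≤m+n _ _
      cost-sum : sumFin (λ z → 𝟙 (A z) * cost z) ≡ 3 * deg A n₀ + 𝟙 (A y)
      cost-sum = trans (sum-cong (λ z → rearrange (𝟙 (A z)) (𝟙 (adj n₀ z)) (𝟙 (z == y))))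
        (trans (sum-+ (λ z → 3 * (𝟙 (A z) * 𝟙 (adj n₀ z))) (λ z → 𝟙 (z == y) * 𝟙 (A z)))
        (cong₂ _+_ (sum-* 3 (λ z → 𝟙 (A z) * 𝟙 (adj n₀ z))) (sum-δ y (𝟙 ∘ A))))
        where
        rearrange : ∀ a b d → a * (3 * b + d) ≡ 3 * (a * b) + d * a
        rearrange a b d = solve (a ∷ b ∷ d ∷ [])
      W-bound : W st A ≤ W st′ A + (3 * deg A n₀ + 𝟙 (A y))
      W-bound = ≤-trans (subst (λ m → W st A ≤ W st₀ A + m) cost-sum (W-cost st st₀ A cost (λ z _ → cost-bound z)))
        (+-monoˡ-≤ _ (≤-trans (W-outside st₀ A n₀ X n∉A) (W-outside st₁ A x X x∉A)))
      cases : ∀ j → deg A n₀ ≡ j → ∀ b → A y ≡ b → 2 * E A + 1 ≤ W st′ A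
      cases zero eq b eqb = bound (E A) (W st A) (W st′ A) (𝟙 (A y)) h
        (subst (λ j → W st A ≤ W st′ A + (3 * j + 𝟙 (A y))) eq W-bound) (𝟙≤1 (A y))
        where
        bound : ∀ e w w′ i → 2 * e + 3 ≤ w → w ≤ w′ + (3 * 0 + i) → i ≤ 1 → 2 * e + 1 ≤ w′
        bound e w w′ i p q r = linear 1 (+-mono-≤ (+-mono-≤ p q) r) (solve (e ∷ w ∷ w′ ∷ i ∷ []))
      -- `n₀` weighs 3, exactly the slack of `gap`, so `A` keeps 4 for each neighbour of `n₀` and
      -- spends 3.
      cases (suc j) eq false eqb = bound (E A) (W st A) (W st′ A) j
        (subst (λ m → 2 * m + 3 ≤ 3 + W st A) (trans (E-▷ n₀ A n∉A) (cong (λ k → E A + 2 * k) eq))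
          (subst (2 * E An + 3 ≤_) (trans (W-▷ st n₀ A n∉A) (cong (λ s → wt s + W st A) stn))
            (gap An An⊆V p q x p≢q (▷-there n₀ A p p∈A) (▷-there n₀ A q q∈A) x∈V x∉An)))
        (subst (λ k → W st A ≤ W st′ A + (3 * k + 0)) eq (subst (λ b → W st A ≤ W st′ A + (3 * deg A n₀ + 𝟙 b)) eqb W-bound))
        where
        bound : ∀ e w w′ j → 2 * (e + 2 * suc j) + 3 ≤ 3 + w → w ≤ w′ + (3 * suc j + 0) → 2 * e + 1 ≤ w′
        bound e w w′ j p q = linear j (+-mono-≤ p q) (solve (e ∷ w ∷ w′ ∷ j ∷ []))
      -- `A` with `n₀` and `x` may be all of `V`, where only `sparse` is available; the edges from
      -- `x` to `n₀` and `y` cost 8, which cancels the weights 5 and 3.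
      cases (suc j) eq true eqb = bound (E A) (W st A) (W st′ A) j (deg An x) deg-x total
        (subst (λ k → W st A ≤ W st′ A + (3 * k + 1)) eq (subst (λ b → W st A ≤ W st′ A + (3 * deg A n₀ + 𝟙 b)) eqb W-bound))
        where
        deg-x : 2 ≤ deg An x
        deg-x = deg-≥2 An x n₀ y (distinct nx) (▷-here n₀ A) (▷-there n₀ A y eqb) (adj₁ nx) (adj₂ nx)
        E≡ : E (x ▷ An) ≡ E A + 2 * suc j + 2 * deg An x
        E≡ = trans (E-▷ x An x∉An) (cong (_+ 2 * deg An x) (trans (E-▷ n₀ A n∉A) (cong (λ k → E A + 2 * k) eq)))
        W≡ : W st (x ▷ An) ≡ 5 + (3 + W st A)
        W≡ = trans (W-▷ st x An x∉An) (cong₂ (λ s m → wt s + m) stx (trans (W-▷ st n₀ A n∉A) (cong (λ s → wt s + W st A) stn)))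
        total : 2 * (E A + 2 * suc j + 2 * deg An x) + 1 ≤ 5 + (3 + W st A)
        total = subst (λ m → 2 * m + 1 ≤ 5 + (3 + W st A)) E≡ (subst (2 * E (x ▷ An) + 1 ≤_) W≡
          (sparse (x ▷ An) (▷-⊆ x An V x∈V An⊆V) x (▷-here x An)))
        bound : ∀ e w w′ j d → 2 ≤ d → 2 * (e + 2 * suc j + 2 * d) + 1 ≤ 5 + (3 + w) → w ≤ w′ + (3 * suc j + 1) → 2 * e + 1 ≤ w′
        bound e w w′ j d p q r = linear j (+-mono-≤ (scale 4 p) (+-mono-≤ q r)) (solve (e ∷ w ∷ w′ ∷ j ∷ d ∷ []))

    result : Colourable G st′ → Colourable G st
    result (c , g) = _ , add-pendant nx g₁ (λ z → proj₁ ∘ kill-live st x z) (kill-⊑ st x) stx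
        (↦-here c n₀ inI) (trans (↦-there c n₀ inI y≢n) y-inF)
      where
      off′ : ∀ z → z ≢ n₀ → z ≢ x → st′ z ≡ st₀ z
      off′ z z≢n z≢x = trans (↦-there st₁ x X z≢x) (↦-there st₀ n₀ X z≢n)
      alive′ : ∀ z → live (st′ z) ≡ true → z ≢ n₀ × z ≢ x
      alive′ z l = proj₂ (kill-live st₀ n₀ z (proj₁ (kill-live st₁ x z l))) , proj₂ (kill-live st₁ x z l)
      near : ∀ z → live (st′ z) ≡ true → adj n₀ z ≡ true → st′ z ≡ forceD (st z)
      near z l a = trans (off′ z (proj₁ (alive′ z l)) (proj₂ (alive′ z l))) (cong (λ b → if b then forceD (st z) else setF st y z) a)
      near-inF : ∀ z → live (st′ z) ≡ true → adj n₀ z ≡ true → c z ≡ inF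
      near-inF z l a = forceD-colour (st z) (subst (_allows c z) (near z l a) (compat g z)) (sub z l)
      near-closed : ∀ z → live (st′ z) ≡ true → adj n₀ z ≡ true → Closed (st′ z)
      near-closed z l a = subst Closed (sym (near z l a)) (forceD-closed (st z) (sub z l))
      st₀-⊑ : ∀ z → st₀ z ⊑ st z
      st₀-⊑ z with adj n₀ z
      ... | true = forceD-⊑ (st z)
      ... | false = setF-⊑ st y z
      rel-n : ∀ z → z ≢ n₀ → st′ z ⊑ kill st x z
      rel-n z z≢n rewrite ==-false z≢n with z ≟ x
      ... | yes _ = ⊑-refl
      ... | no _ = st₀-⊑ z
      at-n : kill st x n₀ ≡ N
      at-n = trans (↦-there st x X n≢x) stn
      -- The edge to `n₀` needs total weight 7, and `n₀` has 3 of it: the other end weighs at least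
      -- 4, hence tolerates `n₀` in I.
      nbr-open : ∀ z → z ∈ V → z ≢ x → adj n₀ z ≡ true → Open (st z)
      nbr-open z z∈V z≢x a = wt≥4⇒Open (st z) (+-cancelˡ-≤ 3 4 _ (subst (λ s → 7 ≤ wt s + wt (st z)) stn
        (pair-gap n₀ z x n∈V z∈V x∈V (n≢x ∘ sym) (z≢x ∘ sym) a)))
      g₁ : Good G (kill st x) (c [ n₀ ↦ inI ])
      g₁ = add-inI G n₀ g (X-colour (compat g n₀) (trans (↦-there st₁ x X n≢x) (↦-here st₀ n₀ X))) rel-n
        (subst (_allows inI) (sym at-n) N-inI)
        (λ z cz a → inI≢inF cz (near-inF z (inI-live (compat g z) cz) a))
        (λ z cz a → let l = inF-live (compat g z) cz; z≢x = proj₂ (alive′ z l) in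
          (λ cl → Open-¬Closed (nbr-open z (sub z l) z≢x a) (subst Closed (↦-there st x X z≢x) cl)) ,
          λ w cw → closed g z w (near-closed z l a) cz cw)
      y-live : live (st′ y) ≡ true
      y-live = trans (cong live (off′ y y≢n y≢x)) (trans (st₀-live y) (live₂ nx))
      y-inF : c y ≡ inF
      y-inF with adj n₀ y in eq
      ... | true = near-inF y y-live eq
      ... | false = setF-colour st y (subst (_allows c y)
        (trans (off′ y y≢n y≢x) (cong (λ b → if b then forceD (st y) else setF st y y) eq)) (compat g y)) (live₂ nx)

  -- `v` enters I and each `c` becomes a leaf hanging off its outer end, which is forced into the
  -- forest at cost 1. The ends may coincide. Only a set containing all three ends could pay 3, one
  -- more than `gap` leaves, and there the deleted claw itself gives the better bound.
  reduce-claw : ∀ v c₁ c₂ c₃ x₁ x₂ x₃ → v ∈ V → st v ≡ P → st c₁ ≡ P → st c₂ ≡ P → st c₃ ≡ P →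
    c₁ ≢ c₂ → c₁ ≢ c₃ → c₂ ≢ c₃ → c₁ ∈ V → c₂ ∈ V → c₃ ∈ V →
    (∀ z → z ∈ V → adj v z ≡ true → z ≡ c₁ ⊎ z ≡ c₂ ⊎ z ≡ c₃) →
    Nbrs₂ c₁ v x₁ → Nbrs₂ c₂ v x₂ → Nbrs₂ c₃ v x₃ →
    (∀ x → x ≡ x₁ ⊎ x ≡ x₂ ⊎ x ≡ x₃ → x ≢ c₁ × x ≢ c₂ × x ≢ c₃) → Colourable G st
  reduce-claw v c₁ c₂ c₃ x₁ x₂ x₃ v∈V stv stc₁ stc₂ stc₃ c₁≢c₂ c₁≢c₃ c₂≢c₃ c₁∈V c₂∈V c₃∈V cov n₁ n₂ n₃ apart =
    result (colour-smaller st′ sub v v∈V (killed k₃ v) sparse′)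
    where
    s₁ = setF st x₁
    s₂ = setF s₁ x₂
    s₃ = setF s₂ x₃
    k₁ = kill s₃ c₁
    k₂ = kill k₁ c₂
    k₃ = kill k₂ c₃
    st′ = kill k₃ v
    s₃-live : ∀ z → live (s₃ z) ≡ live (st z)
    s₃-live z = trans (setF-live s₂ x₃ z) (trans (setF-live s₁ x₂ z) (setF-live st x₁ z))
    alive : ∀ z → live (st′ z) ≡ true → live (s₃ z) ≡ true × z ≢ c₁ × z ≢ c₂ × z ≢ c₃
    alive z l with kill-live k₃ v z l
    ... | l₃ , _ with kill-live k₂ c₃ z l₃
    ... | l₂ , p₃ with kill-live k₁ c₂ z l₂
    ... | l₁ , p₂ with kill-live s₃ c₁ z l₁
    ... | l₀ , p₁ = l₀ , p₁ , p₂ , p₃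
    sub : (live ∘ st′) ⊆ V
    sub z l = trans (sym (s₃-live z)) (proj₁ (alive z l))
    dead₁ : live (st′ c₁) ≡ false
    dead₁ = kill-dead k₃ v c₁ (kill-dead k₂ c₃ c₁ (kill-dead k₁ c₂ c₁ (killed s₃ c₁)))
    dead₂ : live (st′ c₂) ≡ false
    dead₂ = kill-dead k₃ v c₂ (kill-dead k₂ c₃ c₂ (killed k₁ c₂))
    dead₃ : live (st′ c₃) ≡ false
    dead₃ = kill-dead k₃ v c₃ (killed k₂ c₃)
    vc₁ = adj-sym (adj₁ n₁)
    vc₂ = adj-sym (adj₁ n₂)
    vc₃ = adj-sym (adj₁ n₃)

    sparse′ : ∀ A → A ⊆ live ∘ st′ → 2 * E A + 3 ≤ W st A → (∀ p q → p ∈ A → q ∈ A → p ≢ q → 2 * E A + 1 ≤ W st′ A)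
    sparse′ A A⊆ h _ _ _ _ _ = cases (A x₁) (A x₂) (A x₃) refl refl refl
      where
      A⊆V : A ⊆ V
      A⊆V z = sub z ∘ A⊆ z
      c₁∉A = dead-∉ st′ A c₁ A⊆ dead₁
      c₂∉A = dead-∉ st′ A c₂ A⊆ dead₂
      c₃∉A = dead-∉ st′ A c₃ A⊆ dead₃
      v∉A = dead-∉ st′ A v A⊆ (killed k₃ v)
      W-bound : ∀ {b₁ b₂ b₃} → A x₁ ≡ b₁ → A x₂ ≡ b₂ → A x₃ ≡ b₃ → W st A ≤ W st′ A + (𝟙 b₁ + (𝟙 b₂ + 𝟙 b₃))
      W-bound refl refl refl = chain (W st A) (W s₁ A) (W s₂ A) (W s₃ A) (W st′ A) (𝟙 (A x₁)) (𝟙 (A x₂)) (𝟙 (A x₃))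
        (setF-W st A x₁) (setF-W s₁ A x₂) (setF-W s₂ A x₃)
        (≤-trans (W-outside s₃ A c₁ X c₁∉A) (≤-trans (W-outside k₁ A c₂ X c₂∉A)
          (≤-trans (W-outside k₂ A c₃ X c₃∉A) (W-outside k₃ A v X v∉A))))
        where
        chain : ∀ w w₁ w₂ w₃ w′ i j k → w ≤ w₁ + 1 * i → w₁ ≤ w₂ + 1 * j → w₂ ≤ w₃ + 1 * k → w₃ ≤ w′ →
          w ≤ w′ + (i + (j + k))
        chain w w₁ w₂ w₃ w′ i j k p q r s = linear 0 (+-mono-≤ (+-mono-≤ p q) (+-mono-≤ r s))
          (solve (w ∷ w₁ ∷ w₂ ∷ w₃ ∷ w′ ∷ i ∷ j ∷ k ∷ []))
      two : W st A ≤ W st′ A + 2 → 2 * E A + 1 ≤ W st′ A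
      two = bound (E A) (W st A) (W st′ A) h
        where
        bound : ∀ e w w′ → 2 * e + 3 ≤ w → w ≤ w′ + 2 → 2 * e + 1 ≤ w′
        bound e w w′ p q = linear 0 (+-mono-≤ p q) (solve (e ∷ w ∷ w′ ∷ []))
      at-most-two : ∀ {m} → m ≤ 2 → W st A ≤ W st′ A + m → 2 * E A + 1 ≤ W st′ A
      at-most-two m≤2 p = two (≤-trans p (+-monoʳ-≤ (W st′ A) m≤2))
      cases : ∀ b₁ b₂ b₃ → A x₁ ≡ b₁ → A x₂ ≡ b₂ → A x₃ ≡ b₃ → 2 * E A + 1 ≤ W st′ A
      cases false b₂ b₃ p q r = at-most-two (+-mono-≤ (𝟙≤1 b₂) (𝟙≤1 b₃)) (W-bound p q r)
      cases true false b₃ p q r = at-most-two (s≤s (𝟙≤1 b₃)) (W-bound p q r)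
      cases true true false p q r = at-most-two ≤-refl (W-bound p q r)
      -- The four deleted vertices weigh 20 and bring six edges of cost 24, so `A` has potential at
      -- least 5.
      cases true true true x₁∈A x₂∈A x₃∈A = bound (E A) (W st A) (W st′ A) _ _ _ _
        (deg-≥1 A c₁ x₁ x₁∈A (adj₂ n₁))
        (deg-≥1 A₁ c₂ x₂ (▷-there c₁ A x₂ x₂∈A) (adj₂ n₂))
        (deg-≥1 A₂ c₃ x₃ (▷-there c₂ A₁ x₃ (▷-there c₁ A x₃ x₃∈A)) (adj₂ n₃))
        deg-v total (W-bound x₁∈A x₂∈A x₃∈A)
        where
        A₁ = c₁ ▷ A
        A₂ = c₂ ▷ A₁
        A₃ = c₃ ▷ A₂
        A₄ = v ▷ A₃
        c₂∉A₁ = ▷-∉ c₁ A c₂ (c₁≢c₂ ∘ sym) c₂∉A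
        c₃∉A₂ = ▷-∉ c₂ A₁ c₃ (c₂≢c₃ ∘ sym) (▷-∉ c₁ A c₃ (c₁≢c₃ ∘ sym) c₃∉A)
        v∉A₃ = ▷-∉ c₃ A₂ v (adj-≢ vc₃) (▷-∉ c₂ A₁ v (adj-≢ vc₂) (▷-∉ c₁ A v (adj-≢ vc₁) v∉A))
        deg-v : 3 ≤ deg A₃ v
        deg-v rewrite deg-▷ c₃ A₂ c₃∉A₂ v | deg-▷ c₂ A₁ c₂∉A₁ v | deg-▷ c₁ A c₁∉A v | vc₁ | vc₂ | vc₃ =
          s≤s (s≤s (s≤s z≤n))
        E≡ : E A₄ ≡ E A + 2 * deg A c₁ + 2 * deg A₁ c₂ + 2 * deg A₂ c₃ + 2 * deg A₃ v
        E≡ rewrite E-▷ v A₃ v∉A₃ | E-▷ c₃ A₂ c₃∉A₂ | E-▷ c₂ A₁ c₂∉A₁ | E-▷ c₁ A c₁∉A = refl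
        W≡ : W st A₄ ≡ 20 + W st A
        W≡ rewrite W-▷ st v A₃ v∉A₃ | W-▷ st c₃ A₂ c₃∉A₂ | W-▷ st c₂ A₁ c₂∉A₁ | W-▷ st c₁ A c₁∉A
          | stv | stc₁ | stc₂ | stc₃ = refl
        A₄⊆V = ▷-⊆ v A₃ V v∈V (▷-⊆ c₃ A₂ V c₃∈V (▷-⊆ c₂ A₁ V c₂∈V (▷-⊆ c₁ A V c₁∈V A⊆V)))
        total : 2 * (E A + 2 * deg A c₁ + 2 * deg A₁ c₂ + 2 * deg A₂ c₃ + 2 * deg A₃ v) + 1 ≤ 20 + W st A
        total = subst (λ m → 2 * m + 1 ≤ 20 + W st A) E≡ (subst (2 * E A₄ + 1 ≤_) W≡ (sparse A₄ A₄⊆V v (▷-here v A₃)))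
        bound : ∀ e w w′ d₁ d₂ d₃ d → 1 ≤ d₁ → 1 ≤ d₂ → 1 ≤ d₃ → 3 ≤ d →
          2 * (e + 2 * d₁ + 2 * d₂ + 2 * d₃ + 2 * d) + 1 ≤ 20 + w → w ≤ w′ + 3 → 2 * e + 1 ≤ w′
        bound e w w′ d₁ d₂ d₃ d p₁ p₂ p₃ p q r = linear 1
          (+-mono-≤ (scale 4 (+-mono-≤ (+-mono-≤ p₁ p₂) (+-mono-≤ p₃ p))) (+-mono-≤ q r))
          (solve (e ∷ w ∷ w′ ∷ d₁ ∷ d₂ ∷ d₃ ∷ d ∷ []))

    result : Colourable G st′ → Colourable G st
    result (c , g) = _ , add-pendant n₁ g₂ (λ z → proj₁ ∘ kill-live st c₁ z) (kill-⊑ st c₁) stc₁ v-I₂ (x-inF₂ (inj₁ refl))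
      where
      t₁ = kill st c₁
      t₂ = kill t₁ c₂
      t₃ = kill t₂ c₃
      s₁⊑ : ∀ z → s₁ z ⊑ st z
      s₁⊑ = setF-⊑ st x₁
      s₃⊑s₂ : ∀ z → s₃ z ⊑ s₂ z
      s₃⊑s₂ = setF-⊑ s₂ x₃
      s₃⊑s₁ : ∀ z → s₃ z ⊑ s₁ z
      s₃⊑s₁ z = ⊑-trans (s₃⊑s₂ z) (setF-⊑ s₁ x₂ z)
      s₃⊑ : ∀ z → s₃ z ⊑ st z
      s₃⊑ z = ⊑-trans (s₃⊑s₁ z) (s₁⊑ z)
      noNbr : ∀ z → live (st′ z) ≡ true → adj v z ≡ true → ⊥
      noNbr z l a with alive z l | cov z (sub z l) a
      ... | _ , p₁ , p₂ , p₃ | inj₁ e = p₁ e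
      ... | _ , p₁ , p₂ , p₃ | inj₂ (inj₁ e) = p₂ e
      ... | _ , p₁ , p₂ , p₃ | inj₂ (inj₂ e) = p₃ e
      at-v : t₃ v ≡ P
      at-v = trans (↦-there t₂ c₃ X (adj-≢ vc₃)) (trans (↦-there t₁ c₂ X (adj-≢ vc₂)) (trans (↦-there st c₁ X (adj-≢ vc₁)) stv))
      d₀ = c [ v ↦ inI ]
      g₀ : Good G t₃ d₀
      g₀ = add-inI G v g (X-colour (compat g v) (↦-here k₃ v X))
        (λ z z≢v → ⊑-trans (kill-⊑ k₃ v z z≢v) (kill-mono (kill-mono (kill-mono s₃⊑ c₁) c₂) c₃ z))
        (subst (_allows inI) (sym at-v) P-inI)
        (λ z cz a → noNbr z (inI-live (compat g z) cz) a)
        (λ z cz a → ⊥-elim (noNbr z (inF-live (compat g z) cz) a))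
      IsEnd : Fin n → Set
      IsEnd x = x ≡ x₁ ⊎ x ≡ x₂ ⊎ x ≡ x₃
      end-≢v : ∀ {x} → IsEnd x → x ≢ v
      end-≢v (inj₁ refl) = distinct n₁ ∘ sym
      end-≢v (inj₂ (inj₁ refl)) = distinct n₂ ∘ sym
      end-≢v (inj₂ (inj₂ refl)) = distinct n₃ ∘ sym
      end-s₃ : ∀ {x} → IsEnd x → s₃ x allows c x
      end-s₃ {x} e with apart x e
      ... | p₁ , p₂ , p₃ = subst (_allows c x) (trans (↦-there k₃ v X (end-≢v e)) (trans (↦-there k₂ c₃ X p₃)
        (trans (↦-there k₁ c₂ X p₂) (↦-there s₃ c₁ X p₁)))) (compat g x)
      end-inF : ∀ {x} → IsEnd x → c x ≡ inF
      end-inF e@(inj₁ refl) = setF-colour st x₁ (proj₁ (s₃⊑s₁ x₁) _ (end-s₃ e)) (live₂ n₁)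
      end-inF e@(inj₂ (inj₁ refl)) = setF-colour s₁ x₂ (proj₁ (s₃⊑s₂ x₂) _ (end-s₃ e)) (trans (setF-live st x₁ x₂) (live₂ n₂))
      end-inF e@(inj₂ (inj₂ refl)) = setF-colour s₂ x₃ (end-s₃ e)
        (trans (setF-live s₁ x₂ x₃) (trans (setF-live st x₁ x₃) (live₂ n₃)))
      x-inF₀ : ∀ {x} → IsEnd x → d₀ x ≡ inF
      x-inF₀ e = trans (↦-there c v inI (end-≢v e)) (end-inF e)
      g₁ : Good G t₂ (d₀ [ c₃ ↦ inF ])
      g₁ = add-pendant n₃ g₀ (λ z → proj₁ ∘ kill-live st c₁ z ∘ proj₁ ∘ kill-live t₁ c₂ z ∘ proj₁ ∘ kill-live t₂ c₃ z)
        (kill-⊑ t₂ c₃) (trans (↦-there t₁ c₂ X (c₂≢c₃ ∘ sym)) (trans (↦-there st c₁ X (c₁≢c₃ ∘ sym)) stc₃))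
        (↦-here c v inI) (x-inF₀ (inj₂ (inj₂ refl)))
      d₁ = d₀ [ c₃ ↦ inF ]
      v-I₁ : d₁ v ≡ inI
      v-I₁ = trans (↦-there d₀ c₃ inF (adj-≢ vc₃)) (↦-here c v inI)
      x-inF₁ : ∀ {x} → IsEnd x → d₁ x ≡ inF
      x-inF₁ {x} e = trans (↦-there d₀ c₃ inF (proj₂ (proj₂ (apart x e)))) (x-inF₀ e)
      d₂ = d₁ [ c₂ ↦ inF ]
      g₂ : Good G t₁ d₂
      g₂ = add-pendant n₂ g₁ (λ z → proj₁ ∘ kill-live st c₁ z ∘ proj₁ ∘ kill-live t₁ c₂ z)
        (kill-⊑ t₁ c₂) (trans (↦-there st c₁ X (c₁≢c₂ ∘ sym)) stc₂) v-I₁ (x-inF₁ (inj₂ (inj₁ refl)))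
      v-I₂ : d₂ v ≡ inI
      v-I₂ = trans (↦-there d₁ c₂ inF (adj-≢ vc₂)) v-I₁
      x-inF₂ : ∀ {x} → IsEnd x → d₂ x ≡ inF
      x-inF₂ {x} e = trans (↦-there d₁ c₂ inF (proj₁ (proj₂ (apart x e)))) (x-inF₁ e)

-- Discharging.

isP : State → Bool
isP P = true
isP _ = false

isP-true : ∀ {s} → isP s ≡ true → s ≡ P
isP-true {P} _ = refl

≡ᵇ-true : ∀ m n → (m ≡ᵇ n) ≡ true → m ≡ n
≡ᵇ-true zero zero _ = refl
≡ᵇ-true (suc m) (suc n) p = cong suc (≡ᵇ-true m n p)

-- Charges are doubled: a receiving P-vertex of degree 2 needs 2 units.
rateOf : State → ℕ → ℕ
rateOf P d = 𝟙 (3 ≤ᵇ d)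
rateOf F d = 𝟙 (3 ≤ᵇ d)
rateOf D d = 2
rateOf _ d = 0

-- Stands in for a minimal counterexample: either some vertex is reducible and yields a colouring,
-- or all local inequalities hold together.
choose : ∀ {n} {B : Set} {Q : Fin n → Set} → (∀ v → B ⊎ Q v) → B ⊎ (∀ v → Q v)
choose {zero} h = inj₂ λ ()
choose {suc n} h with h zero | choose (h ∘ suc)
... | inj₁ b | _ = inj₁ b
... | inj₂ _ | inj₁ b = inj₁ b
... | inj₂ q | inj₂ qs = inj₂ λ { zero → q ; (suc v) → qs v }

module Discharging {n : ℕ} (G : Graph n) (st : Fin n → State) (sparse : Sparse G st)
  (gap : ∀ A → A ⊆ live ∘ st → ∀ p q r → p ≢ q → p ∈ A → q ∈ A → live (st r) ≡ true → r ∉ A →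
    2 * Potential.E G A + 3 ≤ W st A)
  (smaller : ∀ st′ → (live ∘ st′) ⊆ (live ∘ st) → ∀ r → live (st r) ≡ true → live (st′ r) ≡ false →
    Sparse G st′ → Colourable G st′)
  where
  open Potential G
  open Reductions G st sparse gap smaller

  d : Fin n → ℕ
  d = deg V

  neighbours₂ : ∀ v → d v ≡ 2 → ∃₂ (Nbrs₂ v)
  neighbours₂ v eq with deg-pick V v eq
  ... | x , x∈V , ax , eq₁ with deg-pick (V ∖ x) v eq₁
  ... | y , y∈ , ay , eq₂ = x , y , record
    { distinct = proj₂ (∖-elim V {x} {y} y∈) ∘ sym ; live₁ = x∈V ; live₂ = proj₁ (∖-elim V {x} {y} y∈) ; adj₁ = ax ; adj₂ = ay
    ; cover = cov }
    where
    cov : ∀ z → z ∈ V → adj v z ≡ true → z ≡ x ⊎ z ≡ y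
    cov z z∈V az with z ≟ x | z ≟ y
    ... | yes p | _ = inj₁ p
    ... | no _ | yes p = inj₂ p
    ... | no z≢x | no z≢y = ⊥-elim (deg-zero (V ∖ x ∖ y) v eq₂ z (∖-∈ (V ∖ x) (∖-∈ V z∈V z≢x) z≢y) az)

  swap₂ : ∀ {v x y} → Nbrs₂ v x y → Nbrs₂ v y x
  swap₂ nv = record { distinct = distinct nv ∘ sym ; live₁ = live₂ nv ; live₂ = live₁ nv ; adj₁ = adj₂ nv ; adj₂ = adj₁ nv
    ; cover = λ z z∈V a → flip (cover nv z z∈V a) }
    where
    flip : ∀ {A B : Set} → A ⊎ B → B ⊎ A
    flip (inj₁ a) = inj₂ a
    flip (inj₂ b) = inj₁ b

  neighbours-from : ∀ v x → d v ≡ 2 → x ∈ V → adj v x ≡ true → ∃ (Nbrs₂ v x)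
  neighbours-from v x eq x∈V a = from (neighbours₂ v eq)
    where
    from : ∃₂ (Nbrs₂ v) → ∃ (Nbrs₂ v x)
    from (p , q , nv) = pick (cover nv x x∈V a)
      where
      pick : x ≡ p ⊎ x ≡ q → ∃ (Nbrs₂ v x)
      pick (inj₁ e) = q , subst (λ z → Nbrs₂ v z q) (sym e) nv
      pick (inj₂ e) = p , subst (λ z → Nbrs₂ v z p) (sym e) (swap₂ nv)

  P₂ : VSet n
  P₂ v = isP (st v) ∧ (d v ≡ᵇ 2)

  P₂-elim : ∀ v → v ∈ P₂ → st v ≡ P × d v ≡ 2
  P₂-elim v p with ∧-true p
  ... | q , r = isP-true q , ≡ᵇ-true (d v) 2 r

  P₂⊆V : P₂ ⊆ V
  P₂⊆V v p = cong live (proj₁ (P₂-elim v p))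

  rate : Fin n → ℕ
  rate v = rateOf (st v) (d v)

  received : Fin n → ℕ
  received v = sumFin (λ u → 𝟙 (adj v u) * rate u)

  -- Nonnegative final doubled charge, with the subtracted terms moved to the left.
  Balanced : Fin n → Set
  Balanced v = 2 * (𝟙 (V v) * wt (st v)) + rate v * deg P₂ v ≤ 4 * (𝟙 (V v) * d v) + 𝟙 (P₂ v) * received v

  deg-mono : ∀ A B v → A ⊆ B → deg A v ≤ deg B v
  deg-mono A B v A⊆B = sum-mono term
    where
    term : ∀ u → 𝟙 (A u) * 𝟙 (adj v u) ≤ 𝟙 (B u) * 𝟙 (adj v u)
    term u with A u in eq
    ... | false = z≤n
    ... | true rewrite A⊆B u eq = ≤-refl

  deg-P₂ : ∀ v → deg P₂ v ≤ d v
  deg-P₂ v = deg-mono P₂ V v P₂⊆V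

  deg-P₂-strict : ∀ v z → z ∈ V → adj v z ≡ true → z ∉ P₂ → deg P₂ v + 1 ≤ d v
  deg-P₂-strict v z z∈V a z∉P₂ = subst (deg P₂ v + 1 ≤_)
    (sym (trans (deg-∖ V v z z∈V) (trans (cong (λ b → 𝟙 b + deg (V ∖ z) v) a) (+-comm 1 _))))
    (+-monoˡ-≤ 1 (deg-mono P₂ (V ∖ z) v (λ u p → ∖-∈ V (P₂⊆V u p) (λ { refl → true≢false p z∉P₂ }))))

  received-≥ : ∀ v x y → x ≢ y → adj v x ≡ true → adj v y ≡ true → rate x + rate y ≤ received v
  received-≥ v x y x≢y ax ay = subst (rate x + rate y ≤_)
    (sym (trans (sum-union (∖-disjoint (adj v) x ax) rate) (cong (_+ sumFin (λ u → 𝟙 ((adj v ∖ x) u) * rate u)) (sum-δ x rate))))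
    (+-monoʳ-≤ (rate x) (subst (_≤ sumFin (λ u → 𝟙 ((adj v ∖ x) u) * rate u)) (∈⇒1* (rate y) (∖-∈ (adj v) ay (x≢y ∘ sym)))
      (term≤sum (λ u → 𝟙 ((adj v ∖ x) u) * rate u) y)))

  Result : Fin n → Set
  Result v = Colourable G st ⊎ Balanced v

  low-degree : ∀ v → v ∈ V → ∀ k → d v ≡ k → k ≤ 1 → Colourable G st
  low-degree v v∈V zero eq _ = reduce-leaf v v v∈V (λ y y∈V a → ⊥-elim (deg-zero V v eq y y∈V a))
  low-degree v v∈V (suc zero) eq _ with deg-pick V v eq
  ... | u , _ , _ , eq₁ = reduce-leaf v u v∈V only
    where
    only : ∀ y → y ∈ V → adj v y ≡ true → y ≡ u
    only y y∈V a with y ≟ u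
    ... | yes p = p
    ... | no y≢u = ⊥-elim (deg-zero (V ∖ u) v eq₁ y (∖-∈ V y∈V y≢u) a)
  low-degree v v∈V (suc (suc k)) eq (s≤s ())

  -- The possible neighbours of a receiver once state N and degree at most 1 have been reduced;
  -- `thread` is the kind that gives nothing.
  data Giver (z : Fin n) : Set where
    generous : rate z ≡ 2 → Giver z
    normal : 1 ≤ rate z → Giver z
    thread : Open (st z) → d z ≡ 2 → Giver z

  giver : ∀ v z y → v ∈ V → st v ≡ P → Nbrs₂ v z y → Colourable G st ⊎ Giver z
  giver v z y v∈V stv nv = by (st z) refl (d z) refl
    where
    by : ∀ s → st z ≡ s → ∀ k → d z ≡ k → Colourable G st ⊎ Giver z
    by X eq _ _ = ⊥-elim (true≢false (live₁ nv) (cong live eq))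
    by N eq _ _ = inj₁ (reduce-N z v y eq stv (live₁ nv) v∈V nv)
    by D eq _ _ = inj₂ (generous (cong (λ s → rateOf s (d z)) eq))
    by s eq zero ek = inj₁ (low-degree z (live₁ nv) 0 ek z≤n)
    by s eq (suc zero) ek = inj₁ (low-degree z (live₁ nv) 1 ek ≤-refl)
    by P eq (suc (suc zero)) ek = inj₂ (thread (subst Open (sym eq) P-open) ek)
    by F eq (suc (suc zero)) ek = inj₂ (thread (subst Open (sym eq) F-open) ek)
    by P eq (suc (suc (suc k))) ek = inj₂ (normal (≤-reflexive (sym (cong₂ rateOf eq ek))))
    by F eq (suc (suc (suc k))) ek = inj₂ (normal (≤-reflexive (sym (cong₂ rateOf eq ek))))

  module AtThread (v : Fin n) (v∈V : v ∈ V) (stv : st v ≡ P) where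

    cut-thread : ∀ a u → Nbrs₂ v a u → Open (st a) → d a ≡ 2 → Open (st u) → Colourable G st
    cut-thread a u na oa da ou = finish (neighbours-from a v da v∈V (adj-sym (adj₁ na)))
      where
      finish : ∃ (Nbrs₂ a v) → Colourable G st
      finish (w , nw) = reduce-thread a v w u stv oa ou v∈V na nw

    open-or-2 : ∀ s k → 1 ≤ rateOf s k → Open s ⊎ rateOf s k ≡ 2
    open-or-2 P _ _ = inj₁ P-open
    open-or-2 F _ _ = inj₁ F-open
    open-or-2 D _ _ = inj₂ refl

    -- If one neighbour is an open vertex of degree 2, `reduce-thread` rules out an open second
    -- neighbour; that one is then in state D and gives 2 alone. Otherwise both neighbours give at
    -- least 1, or one gives 2.
    receives-2 : ∀ x y → Nbrs₂ v x y → Colourable G st ⊎ 2 ≤ received v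
    receives-2 x y nv = both (giver v x y v∈V stv nv) (giver v y x v∈V stv (swap₂ nv))
      where
      Out : Set
      Out = Colourable G st ⊎ 2 ≤ received v
      total : rate x + rate y ≤ received v
      total = received-≥ v x y (distinct nv) (adj₁ nv) (adj₂ nv)
      two-x : rate x ≡ 2 → Out
      two-x e = inj₂ (≤-trans (≤-trans (≤-reflexive (sym e)) (m≤m+n (rate x) (rate y))) total)
      two-y : rate y ≡ 2 → Out
      two-y e = inj₂ (≤-trans (≤-trans (≤-reflexive (sym e)) (m≤n+m (rate y) (rate x))) total)
      thread-x : Open (st x) → d x ≡ 2 → Open (st y) ⊎ rate y ≡ 2 → Out
      thread-x ox dx (inj₁ oy) = inj₁ (cut-thread x y nv ox dx oy)
      thread-x ox dx (inj₂ e) = two-y e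
      thread-y : Open (st y) → d y ≡ 2 → Open (st x) ⊎ rate x ≡ 2 → Out
      thread-y oy dy (inj₁ ox) = inj₁ (cut-thread y x (swap₂ nv) oy dy ox)
      thread-y oy dy (inj₂ e) = two-x e
      by : Giver x → Giver y → Out
      by (generous e) _ = two-x e
      by (normal p) (generous e) = two-y e
      by (thread _ _) (generous e) = two-y e
      by (normal p) (normal q) = inj₂ (≤-trans (+-mono-≤ p q) total)
      by (thread ox dx) (thread oy _) = thread-x ox dx (inj₁ oy)
      by (thread ox dx) (normal q) = thread-x ox dx (open-or-2 (st y) (d y) q)
      by (normal p) (thread oy dy) = thread-y oy dy (open-or-2 (st x) (d x) p)
      both : Colourable G st ⊎ Giver x → Colourable G st ⊎ Giver y → Out
      both (inj₁ c) _ = inj₁ c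
      both (inj₂ _) (inj₁ c) = inj₁ c
      both (inj₂ gx) (inj₂ gy) = by gx gy

  open AtThread

  -- An outer end in `P₂` would make the arm a thread between that end and `v`, which is reducible.
  -- So the ends lie outside `P₂`, and this is what separates them from the three arms.
  claw : ∀ v c₁ c₂ c₃ → v ∈ V → st v ≡ P → c₁ ≢ c₂ → c₁ ≢ c₃ → c₂ ≢ c₃ →
    adj v c₁ ≡ true → adj v c₂ ≡ true → adj v c₃ ≡ true →
    (∀ z → z ∈ V → adj v z ≡ true → z ≡ c₁ ⊎ z ≡ c₂ ⊎ z ≡ c₃) →
    c₁ ∈ P₂ → c₂ ∈ P₂ → c₃ ∈ P₂ → Colourable G st
  claw v c₁ c₂ c₃ v∈V stv c₁≢c₂ c₁≢c₃ c₂≢c₃ a₁ a₂ a₃ cov p₁ p₂ p₃ = go (arm c₁ p₁ a₁) (arm c₂ p₂ a₂) (arm c₃ p₃ a₃)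
    where
    Arm : Fin n → Set
    Arm c = ∃ λ x → Nbrs₂ c v x × x ∉ P₂
    v-open : Open (st v)
    v-open = subst Open (sym stv) P-open
    arm : ∀ c → c ∈ P₂ → adj v c ≡ true → Colourable G st ⊎ Arm c
    arm c p a = from (neighbours-from c v (proj₂ (P₂-elim c p)) v∈V (adj-sym a))
      where
      from : ∃ (Nbrs₂ c v) → Colourable G st ⊎ Arm c
      from (x , nx) = by (P₂ x) refl
        where
        by : ∀ b → P₂ x ≡ b → Colourable G st ⊎ Arm c
        by false x∉ = inj₂ (x , nx , x∉)
        by true x∈ = inj₁ (cut-thread c (P₂⊆V c p) (proj₁ (P₂-elim c p)) x v (swap₂ nx)
          (subst Open (sym (proj₁ (P₂-elim x x∈))) P-open) (proj₂ (P₂-elim x x∈)) v-open)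
    go : Colourable G st ⊎ Arm c₁ → Colourable G st ⊎ Arm c₂ → Colourable G st ⊎ Arm c₃ → Colourable G st
    go (inj₁ c) _ _ = c
    go _ (inj₁ c) _ = c
    go _ _ (inj₁ c) = c
    go (inj₂ (x₁ , n₁ , q₁)) (inj₂ (x₂ , n₂ , q₂)) (inj₂ (x₃ , n₃ , q₃)) =
      reduce-claw v c₁ c₂ c₃ x₁ x₂ x₃ v∈V stv (isP₂ c₁ p₁) (isP₂ c₂ p₂) (isP₂ c₃ p₃) c₁≢c₂ c₁≢c₃ c₂≢c₃
        (P₂⊆V c₁ p₁) (P₂⊆V c₂ p₂) (P₂⊆V c₃ p₃) cov n₁ n₂ n₃ apart
      where
      isP₂ : ∀ c → c ∈ P₂ → st c ≡ P
      isP₂ c p = proj₁ (P₂-elim c p)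
      ≢-arm : ∀ {x} → x ∉ P₂ → ∀ {c} → c ∈ P₂ → x ≢ c
      ≢-arm q p refl = true≢false p q
      apart : ∀ x → x ≡ x₁ ⊎ x ≡ x₂ ⊎ x ≡ x₃ → x ≢ c₁ × x ≢ c₂ × x ≢ c₃
      apart x e = ≢-arm q p₁ , ≢-arm q p₂ , ≢-arm q p₃
        where
        outside : x ≡ x₁ ⊎ x ≡ x₂ ⊎ x ≡ x₃ → x ∉ P₂
        outside (inj₁ e) = subst (_∉ P₂) (sym e) q₁
        outside (inj₂ (inj₁ e)) = subst (_∉ P₂) (sym e) q₂
        outside (inj₂ (inj₂ e)) = subst (_∉ P₂) (sym e) q₃
        q = outside e

  -- The doubled charge 4 * 3 - 2 * 5 = 2 pays for two receivers, so three of them must be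
  -- reducible.
  cubic : ∀ v → v ∈ V → st v ≡ P → d v ≡ 3 → Colourable G st ⊎ deg P₂ v + 1 ≤ d v
  cubic v v∈V stv eq = from₁ (deg-pick V v eq)
    where
    Out : Set
    Out = Colourable G st ⊎ deg P₂ v + 1 ≤ d v
    from₁ : (∃ λ x → x ∈ V × adj v x ≡ true × deg (V ∖ x) v ≡ 2) → Out
    from₁ (c₁ , c₁∈V , a₁ , eq₁) = from₂ (deg-pick (V ∖ c₁) v eq₁)
      where
      from₂ : (∃ λ x → x ∈ V ∖ c₁ × adj v x ≡ true × deg (V ∖ c₁ ∖ x) v ≡ 1) → Out
      from₂ (c₂ , c₂∈ , a₂ , eq₂) = from₃ (deg-pick (V ∖ c₁ ∖ c₂) v eq₂)
        where
        from₃ : (∃ λ x → x ∈ V ∖ c₁ ∖ c₂ × adj v x ≡ true × deg (V ∖ c₁ ∖ c₂ ∖ x) v ≡ 0) → Out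
        from₃ (c₃ , c₃∈ , a₃ , eq₃) = by (P₂ c₁) (P₂ c₂) (P₂ c₃) refl refl refl
          where
          c₂∈V = proj₁ (∖-elim V {c₁} {c₂} c₂∈)
          c₂≢c₁ = proj₂ (∖-elim V {c₁} {c₂} c₂∈)
          c₃∈′ = proj₁ (∖-elim (V ∖ c₁) {c₂} {c₃} c₃∈)
          c₃≢c₂ = proj₂ (∖-elim (V ∖ c₁) {c₂} {c₃} c₃∈)
          c₃∈V = proj₁ (∖-elim V {c₁} {c₃} c₃∈′)
          c₃≢c₁ = proj₂ (∖-elim V {c₁} {c₃} c₃∈′)
          cov : ∀ z → z ∈ V → adj v z ≡ true → z ≡ c₁ ⊎ z ≡ c₂ ⊎ z ≡ c₃
          cov z z∈V a with z ≟ c₁ | z ≟ c₂ | z ≟ c₃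
          ... | yes p | _ | _ = inj₁ p
          ... | no _ | yes p | _ = inj₂ (inj₁ p)
          ... | no _ | no _ | yes p = inj₂ (inj₂ p)
          ... | no p | no q | no r = ⊥-elim (deg-zero (V ∖ c₁ ∖ c₂ ∖ c₃) v eq₃ z
            (∖-∈ (V ∖ c₁ ∖ c₂) (∖-∈ (V ∖ c₁) (∖-∈ V z∈V p) q) r) a)
          by : ∀ b₁ b₂ b₃ → P₂ c₁ ≡ b₁ → P₂ c₂ ≡ b₂ → P₂ c₃ ≡ b₃ → Out
          by false _ _ p _ _ = inj₂ (deg-P₂-strict v c₁ c₁∈V a₁ p)
          by true false _ _ p _ = inj₂ (deg-P₂-strict v c₂ c₂∈V a₂ p)
          by true true false _ _ p = inj₂ (deg-P₂-strict v c₃ c₃∈V a₃ p)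
          by true true true p₁ p₂ p₃ = inj₁ (claw v c₁ c₂ c₃ v∈V stv (c₂≢c₁ ∘ sym) (c₃≢c₁ ∘ sym) (c₃≢c₂ ∘ sym)
            a₁ a₂ a₃ cov p₁ p₂ p₃)

  balanced : ∀ v s k → st v ≡ s → d v ≡ k →
    2 * (𝟙 (live s) * wt s) + rateOf s k * deg P₂ v ≤ 4 * (𝟙 (live s) * k) + 𝟙 (isP s ∧ (k ≡ᵇ 2)) * received v → Balanced v
  balanced v s k refl refl h = h

  local : ∀ v → Result v
  local v = by (st v) refl (d v) refl
    where
    dp : ℕ
    dp = deg P₂ v
    dp≤ : ∀ {k} → d v ≡ k → dp ≤ k
    dp≤ e = ≤-trans (deg-P₂ v) (≤-reflexive e)
    r : ℕ
    r = received v
    by : ∀ s → st v ≡ s → ∀ k → d v ≡ k → Result v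
    by X e k ek = inj₂ (balanced v X k e ek z≤n)
    by P e zero ek = inj₁ (low-degree v (cong live e) 0 ek z≤n)
    by P e (suc zero) ek = inj₁ (low-degree v (cong live e) 1 ek ≤-refl)
    by F e zero ek = inj₁ (low-degree v (cong live e) 0 ek z≤n)
    by F e (suc zero) ek = inj₁ (low-degree v (cong live e) 1 ek ≤-refl)
    by N e zero ek = inj₁ (low-degree v (cong live e) 0 ek z≤n)
    by N e (suc zero) ek = inj₁ (low-degree v (cong live e) 1 ek ≤-refl)
    by D e zero ek = inj₁ (low-degree v (cong live e) 0 ek z≤n)
    by D e (suc zero) ek = inj₁ (low-degree v (cong live e) 1 ek ≤-refl)
    by N e (suc (suc k)) ek = inj₂ (balanced v N _ e ek (bound dp k r))
      where
      bound : ∀ p k r → 2 * (1 * 3) + 0 * p ≤ 4 * (1 * suc (suc k)) + 0 * r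
      bound p k r = linear (2 + 4 * k) (z≤n {0}) (solve (p ∷ k ∷ r ∷ []))
    -- At degree m the doubled charge is 4m - 4 and the gifts total at most 2m, so degree 2 is just
    -- enough.
    by D e (suc (suc k)) ek = inj₂ (balanced v D _ e ek (bound dp k r (dp≤ ek)))
      where
      bound : ∀ p k r → p ≤ suc (suc k) → 2 * (1 * 2) + 2 * p ≤ 4 * (1 * suc (suc k)) + 0 * r
      bound p k r h = linear (2 * k) (scale 2 h) (solve (p ∷ k ∷ r ∷ []))
    by F e (suc (suc zero)) ek = inj₂ (balanced v F _ e ek ≤-refl)
    by F e (suc (suc (suc k))) ek = inj₂ (balanced v F _ e ek (bound dp k r (dp≤ ek)))
      where
      bound : ∀ p k r → p ≤ suc (suc (suc k)) → 2 * (1 * 4) + 1 * p ≤ 4 * (1 * suc (suc (suc k))) + 0 * r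
      bound p k r h = linear (1 + 3 * k) h (solve (p ∷ k ∷ r ∷ []))
    by P e (suc (suc zero)) ek = degree-two (neighbours₂ v ek)
      where
      finish : Colourable G st ⊎ 2 ≤ received v → Result v
      finish (inj₁ c) = inj₁ c
      finish (inj₂ h) = inj₂ (balanced v P _ e ek (bound dp r h))
        where
        bound : ∀ p r → 2 ≤ r → 2 * (1 * 5) + 0 * p ≤ 4 * (1 * 2) + 1 * r
        bound p r h = linear 0 h (solve (p ∷ r ∷ []))
      degree-two : ∃₂ (Nbrs₂ v) → Result v
      degree-two (x , y , nv) = finish (receives-2 v (cong live e) e x y nv)
    by P e (suc (suc (suc zero))) ek = finish (cubic v (cong live e) e ek)
      where
      finish : Colourable G st ⊎ dp + 1 ≤ d v → Result v
      finish (inj₁ c) = inj₁ c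
      finish (inj₂ h) = inj₂ (balanced v P _ e ek (bound dp r (≤-trans h (≤-reflexive ek))))
        where
        bound : ∀ p r → p + 1 ≤ 3 → 2 * (1 * 5) + 1 * p ≤ 4 * (1 * 3) + 0 * r
        bound p r h = linear 0 h (solve (p ∷ r ∷ []))
    -- From degree 4 on, 4m - 10 exceeds m, so every neighbour may receive.
    by P e (suc (suc (suc (suc k)))) ek = inj₂ (balanced v P _ e ek (bound dp k r (dp≤ ek)))
      where
      bound : ∀ p k r → p ≤ suc (suc (suc (suc k))) → 2 * (1 * 5) + 1 * p ≤ 4 * (1 * suc (suc (suc (suc k)))) + 0 * r
      bound p k r h = linear (2 + 3 * k) h (solve (p ∷ k ∷ r ∷ []))

  -- Both sides sum the rate of `v` over the adjacent pairs of a giver `v` and a receiver `u`, in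
  -- opposite orders.
  given≡received : sumFin (λ v → rate v * deg P₂ v) ≡ sumFin (λ v → 𝟙 (P₂ v) * received v)
  given≡received = trans (sum-cong (λ v → sym (sum-* (rate v) (λ u → 𝟙 (P₂ u) * 𝟙 (adj v u)))))
    (trans (sum-swap (λ v u → rate v * (𝟙 (P₂ u) * 𝟙 (adj v u))))
    (sum-cong (λ u → trans (sum-cong (λ v → term v u)) (sum-* (𝟙 (P₂ u)) (λ v → 𝟙 (adj u v) * rate v)))))
    where
    rearrange : ∀ a b c → a * (b * c) ≡ b * (c * a)
    rearrange a b c = solve (a ∷ b ∷ c ∷ [])
    term : ∀ v u → rate v * (𝟙 (P₂ u) * 𝟙 (adj v u)) ≡ 𝟙 (P₂ u) * (𝟙 (adj u v) * rate v)
    term v u = trans (rearrange (rate v) (𝟙 (P₂ u)) (𝟙 (adj v u)))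
      (cong (λ b → 𝟙 (P₂ u) * (𝟙 b * rate v)) (Graph.sym G v u))

  overcharged : (∀ v → Balanced v) → ∀ x → x ∈ V → ⊥
  overcharged h x x∈V = bound (E V) (W st V) _ (sparse V (λ _ p → p) x x∈V)
    (subst (λ m → 2 * W st V + m ≤ 4 * E V + sumFin (λ v → 𝟙 (P₂ v) * received v)) given≡received total)
    where
    total : 2 * W st V + sumFin (λ v → rate v * deg P₂ v) ≤ 4 * E V + sumFin (λ v → 𝟙 (P₂ v) * received v)
    total = subst₂ _≤_
      (trans (sum-+ (λ v → 2 * (𝟙 (V v) * wt (st v))) (λ v → rate v * deg P₂ v))
        (cong (_+ sumFin (λ v → rate v * deg P₂ v)) (sum-* 2 (λ v → 𝟙 (V v) * wt (st v)))))
      (trans (sum-+ (λ v → 4 * (𝟙 (V v) * d v)) (λ v → 𝟙 (P₂ v) * received v))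
        (cong (_+ sumFin (λ v → 𝟙 (P₂ v) * received v)) (sum-* 4 (λ v → 𝟙 (V v) * d v))))
      (sum-mono h)
    bound : ∀ e w s → 2 * e + 1 ≤ w → 2 * w + s ≤ 4 * e + s → ⊥
    bound e w s p q = 1≰0 (linear 1 (+-mono-≤ (scale 2 p) q) (solve (e ∷ w ∷ s ∷ [])))
      where
      1≰0 : 1 ≤ 0 → ⊥
      1≰0 ()

  colourable : ∀ x → x ∈ V → Colourable G st
  colourable x x∈V = finish (choose local)
    where
    finish : Colourable G st ⊎ (∀ v → Balanced v) → Colourable G st
    finish (inj₁ c) = c
    finish (inj₂ h) = ⊥-elim (overcharged h x x∈V)

-- Contracting a coloured set.

weaken : ∀ {n} {G : Graph n} {st st′ c} → (∀ v → st v ⊑ st′ v) → Good G st c → Good G st′ c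
weaken h g = record
  { compat = λ v → proj₁ (h v) _ (compat g v)
  ; I-I = I-I g
  ; I-F-I = I-F-I g
  ; closed = λ w u cl → closed g w u (proj₂ (h w) cl)
  ; forest = forest g
  }

restrict : ∀ {n} → (Fin n → State) → VSet n → Fin n → State
restrict st A v = if A v then st v else X

isI isF : Colour → Bool
isI inI = true
isI _ = false
isF inF = true
isF _ = false

isI-true : ∀ {c} → isI c ≡ true → c ≡ inI
isI-true {inI} _ = refl

in-or-out : ∀ {n} (A : VSet n) v → v ∈ A ⊎ v ∉ A
in-or-out A v with A v
... | true = inj₁ refl
... | false = inj₂ refl

_∪_ : ∀ {n} → VSet n → VSet n → VSet n
(A ∪ B) v = A v ∨ B v

∪-disjoint : ∀ {n} (A B : VSet n) → (∀ v → v ∈ B → v ∉ A) → DisjointUnion (A ∪ B) A B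
∪-disjoint A B h = disjoint eq
  where
  eq : ∀ v → 𝟙 (A v ∨ B v) ≡ 𝟙 (A v) + 𝟙 (B v)
  eq v with B v in b
  ... | true rewrite h v b = refl
  ... | false with A v
  ...   | true = refl
  ...   | false = refl

module Touch {n : ℕ} (G : Graph n) where
  open Potential G

  touch : VSet n → VSet n
  touch B z = 1 ≤ᵇ deg B z

  touch-intro : ∀ B z s → s ∈ B → adj z s ≡ true → z ∈ touch B
  touch-intro B z s s∈B a with deg B z | deg-≥1 B z s s∈B a
  ... | suc _ | _ = refl

  touch-elim : ∀ B z → z ∈ touch B → ∃ λ s → s ∈ B × adj z s ≡ true
  touch-elim B z p = deg-positive B z (positive (deg B z) p)
    where
    positive : ∀ k → (1 ≤ᵇ k) ≡ true → 0 < k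
    positive (suc k) _ = s≤s z≤n

  touch-≤ : ∀ B z → 𝟙 (touch B z) ≤ deg B z
  touch-≤ B z with deg B z
  ... | zero = z≤n
  ... | suc _ = s≤s z≤n

  touching : VSet n → VSet n → ℕ
  touching B A′ = sumFin (λ v → 𝟙 (A′ v) * 𝟙 (touch B v))

  -- A vertex touching both parts has at least two neighbours in `A`, which covers its being counted
  -- twice.
  touching-≤ : ∀ {A B C} → DisjointUnion A B C → ∀ A′ → touching B A′ + touching C A′ ≤ cut A′ A
  touching-≤ {A} {B} {C} h A′ = ≤-trans (≤-reflexive (sym (sum-+ (λ v → 𝟙 (A′ v) * 𝟙 (touch B v)) (λ v → 𝟙 (A′ v) * 𝟙 (touch C v)))))
    (sum-mono (λ v → ≤-trans (≤-reflexive (sym (*-distribˡ-+ (𝟙 (A′ v)) (𝟙 (touch B v)) (𝟙 (touch C v)))))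
      (*-monoʳ-≤ (𝟙 (A′ v)) (≤-trans (+-mono-≤ (touch-≤ B v) (touch-≤ C v)) (≤-reflexive (sym (deg-union h v)))))))

-- G with A contracted to w, keeping only the edges that leave A from the colour class inF.
module Contraction {n : ℕ} (G : Graph n) (st : Fin n → State) (A : VSet n) (w : Fin n) (w∈A : w ∈ A)
  (A⊆V : A ⊆ live ∘ st) (cA : Fin n → Colour) (gA : Good G (restrict st A) cA) where
  open Potential G
  open Touch G

  BI BF : VSet n
  BI v = isI (cA v)
  BF v = isF (cA v)

  at-A : ∀ {v} → v ∈ A → restrict st A v ≡ st v
  at-A {v} p = cong (λ b → if b then st v else X) p

  off-A : ∀ {v} → v ∉ A → cA v ≡ off
  off-A {v} p = X-colour (compat gA v) (cong (λ b → if b then st v else X) p)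

  colour-A : ∀ {v} → v ∈ A → cA v ≡ inI ⊎ cA v ≡ inF
  colour-A {v} p = live-colour (compat gA v) (trans (cong live (at-A p)) (A⊆V v p))

  A-disjoint : DisjointUnion A BF BI
  A-disjoint = disjoint eq
    where
    eq : ∀ v → 𝟙 (A v) ≡ 𝟙 (BF v) + 𝟙 (BI v)
    eq v with in-or-out A v
    ... | inj₂ p rewrite p | off-A p = refl
    ... | inj₁ p with colour-A p
    ...   | inj₁ c rewrite p | c = refl
    ...   | inj₂ c rewrite p | c = refl

  -- Parallel edges into `w` merge without loss because a live vertex outside a light `A` has at
  -- most one neighbour in `A`. The edges from the I-part are dropped, since their effect is
  -- recorded in `st′`.
  adj-glue : Bool → Bool → Fin n → Fin n → Bool
  adj-glue true true u v = false
  adj-glue true false u v = u == w ∧ touch BF v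
  adj-glue false true u v = v == w ∧ touch BF u
  adj-glue false false u v = adj u v

  G′ : Graph n
  G′ = record { Adj = λ u v → adj-glue (A u) (A v) u v ; sym = λ u v → glue-sym (A u) (A v) u v ; irrefl = λ v → glue-irrefl (A v) v }
    where
    glue-sym : ∀ a b u v → adj-glue a b u v ≡ adj-glue b a v u
    glue-sym true true u v = refl
    glue-sym true false u v = refl
    glue-sym false true u v = refl
    glue-sym false false u v = Graph.sym G u v
    glue-irrefl : ∀ a v → adj-glue a a v v ≡ false
    glue-irrefl true v = refl
    glue-irrefl false v = irrefl G v

  adj′ : Fin n → Fin n → Bool
  adj′ = Adj G′

  adj′-out : ∀ {u v} → u ∉ A → v ∉ A → adj′ u v ≡ adj u v
  adj′-out {u} {v} p q = cong₂ (λ a b → adj-glue a b u v) p q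

  adj′-w : ∀ {v} → v ∉ A → adj′ w v ≡ touch BF v
  adj′-w {v} p = trans (cong₂ (λ a b → adj-glue a b w v) w∈A p) (cong (_∧ touch BF v) (==-refl w))

  adj′-to-w : ∀ {v} → v ∉ A → adj′ v w ≡ touch BF v
  adj′-to-w {v} p = trans (Graph.sym G′ v w) (adj′-w p)

  -- No vertex of I may face I across the boundary, or meet it at a common neighbour. State D at `w`
  -- keeps I away from the forest part of `A`; `forceD` keeps each neighbour of the I-part out of I
  -- and away from further vertices of I.
  st′ : Fin n → State
  st′ v = if A v then (if v == w then D else X) else (if touch BI v then forceD (st v) else st v)

  st′-w : st′ w ≡ D
  st′-w rewrite w∈A | ==-refl w = refl

  st′-A : ∀ v → v ∈ A → live (st′ v) ≡ true → v ≡ w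
  st′-A v p l rewrite p with v ≟ w
  ... | yes e = e
  st′-A v p () | no _

  st′-⊑ : ∀ v → v ∉ A → st′ v ⊑ st v
  st′-⊑ v p rewrite p with touch BI v
  ... | true = forceD-⊑ (st v)
  ... | false = ⊑-refl

  st′-live : ∀ v → v ∉ A → live (st′ v) ≡ live (st v)
  st′-live v p rewrite p with touch BI v
  ... | true = forceD-live (st v)
  ... | false = refl

  st′-touch : ∀ v → v ∉ A → v ∈ touch BI → st′ v ≡ forceD (st v)
  st′-touch v p q rewrite p | q = refl

  st′-cost : ∀ v → v ∉ A → wt (st v) ≤ wt (st′ v) + 3 * 𝟙 (touch BI v)
  st′-cost v p rewrite p with touch BI v
  ... | true = forceD-wt (st v)
  ... | false = m≤m+n _ _

  module Glue (c′ : Fin n → Colour) (g′ : Good G′ st′ c′)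
    (one : ∀ z s s′ → z ∉ A → live (st z) ≡ true → s ∈ A → s′ ∈ A → adj z s ≡ true → adj z s′ ≡ true → s ≡ s′)
    (openI : ∀ z → z ∉ A → live (st z) ≡ true → z ∈ touch BI → Open (st z))
    where

    c : Fin n → Colour
    c v = if A v then cA v else c′ v

    c-in : ∀ {v} → v ∈ A → c v ≡ cA v
    c-in {v} p = cong (λ b → if b then cA v else c′ v) p

    c-out : ∀ {v} → v ∉ A → c v ≡ c′ v
    c-out {v} p = cong (λ b → if b then cA v else c′ v) p

    w-inF : c′ w ≡ inF
    w-inF = D-colour (subst (_allows c′ w) st′-w (compat g′ w))
      where
      D-colour : ∀ {k} → D allows k → k ≡ inF
      D-colour D-inF = refl

    inF-in : ∀ {v} → v ∈ A → c v ≡ inF → v ∈ BF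
    inF-in p q = cong isF (trans (sym (c-in p)) q)

    inI-in : ∀ {v} → v ∈ A → c v ≡ inI → v ∈ BI
    inI-in p q = cong isI (trans (sym (c-in p)) q)

    liveF : ∀ {v} → v ∉ A → c v ≡ inF → live (st v) ≡ true
    liveF {v} p q = trans (sym (st′-live v p)) (inF-live (compat g′ v) (trans (sym (c-out p)) q))

    liveI : ∀ {v} → v ∉ A → c v ≡ inI → live (st v) ≡ true
    liveI {v} p q = trans (sym (st′-live v p)) (inI-live (compat g′ v) (trans (sym (c-out p)) q))

    no-crossing-I : ∀ z s → z ∉ A → s ∈ A → c z ≡ inI → adj z s ≡ true → ⊥
    no-crossing-I z s z∉A s∈A cz a with colour-A s∈A
    ... | inj₁ cs = inI≢inF (trans (sym (c-out z∉A)) cz) (forceD-colour (st z)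
      (subst (_allows c′ z) (st′-touch z z∉A (touch-intro BI z s (cong isI cs) a)) (compat g′ z)) (liveI z∉A cz))
    ... | inj₂ cs = closed g′ w z (subst Closed (sym st′-w) D-closed) w-inF (trans (sym (c-out z∉A)) cz)
      (trans (adj′-w z∉A) (touch-intro BF z s (cong isF cs) a))

    closed-crossing : ∀ z s → z ∉ A → s ∈ A → c z ≡ inF → c s ≡ inI → adj z s ≡ true → Closed (st′ z)
    closed-crossing z s z∉A s∈A cz cs a = subst Closed
      (sym (st′-touch z z∉A (touch-intro BI z s (inI-in s∈A cs) a))) (forceD-closed (st z) (liveF z∉A cz))

    out-adj : ∀ {u v} → u ∉ A → v ∉ A → adj u v ≡ true → adj′ u v ≡ true
    out-adj p q a = trans (adj′-out p q) a

    compat-glue : ∀ v → st v allows c v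
    compat-glue v with in-or-out A v
    ... | inj₁ p = subst₂ _allows_ (at-A p) (sym (c-in p)) (compat gA v)
    ... | inj₂ p = subst (st v allows_) (sym (c-out p)) (proj₁ (st′-⊑ v p) _ (compat g′ v))

    I-I-glue : ∀ u v → c u ≡ inI → c v ≡ inI → adj u v ≡ true → ⊥
    I-I-glue u v cu cv a with in-or-out A u | in-or-out A v
    ... | inj₁ p | inj₁ q = I-I gA u v (trans (sym (c-in p)) cu) (trans (sym (c-in q)) cv) a
    ... | inj₁ p | inj₂ q = no-crossing-I v u q p cv (adj-sym a)
    ... | inj₂ p | inj₁ q = no-crossing-I u v p q cu a
    ... | inj₂ p | inj₂ q = I-I g′ u v (trans (sym (c-out p)) cu) (trans (sym (c-out q)) cv) (out-adj p q a)

    I-F-I-glue : ∀ x u v → c x ≡ inF → c u ≡ inI → c v ≡ inI → adj x u ≡ true → adj x v ≡ true → u ≡ v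
    I-F-I-glue x u v cx cu cv au av with in-or-out A x | in-or-out A u | in-or-out A v
    ... | inj₁ p | inj₁ q | inj₁ r = I-F-I gA x u v (trans (sym (c-in p)) cx) (trans (sym (c-in q)) cu) (trans (sym (c-in r)) cv) au av
    ... | inj₁ p | inj₂ q | _ = ⊥-elim (no-crossing-I u x q p cu (adj-sym au))
    ... | inj₁ p | inj₁ _ | inj₂ r = ⊥-elim (no-crossing-I v x r p cv (adj-sym av))
    ... | inj₂ p | inj₁ q | inj₁ r = one x u v p (liveF p cx) q r au av
    ... | inj₂ p | inj₁ q | inj₂ r = ⊥-elim (closed g′ x v (closed-crossing x u p q cx cu au)
      (trans (sym (c-out p)) cx) (trans (sym (c-out r)) cv) (out-adj p r av))
    ... | inj₂ p | inj₂ q | inj₁ r = ⊥-elim (closed g′ x u (closed-crossing x v p r cx cv av)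
      (trans (sym (c-out p)) cx) (trans (sym (c-out q)) cu) (out-adj p q au))
    ... | inj₂ p | inj₂ q | inj₂ r = I-F-I g′ x u v (trans (sym (c-out p)) cx) (trans (sym (c-out q)) cu)
      (trans (sym (c-out r)) cv) (out-adj p q au) (out-adj p r av)

    closed-glue : ∀ x u → Closed (st x) → c x ≡ inF → c u ≡ inI → adj x u ≡ true → ⊥
    closed-glue x u cl cx cu a with in-or-out A x | in-or-out A u
    ... | inj₁ p | inj₁ q = closed gA x u (subst Closed (sym (at-A p)) cl) (trans (sym (c-in p)) cx) (trans (sym (c-in q)) cu) a
    ... | inj₁ p | inj₂ q = no-crossing-I u x q p cu (adj-sym a)
    ... | inj₂ p | inj₁ q = Open-¬Closed (openI x p (liveF p cx) (touch-intro BI x u (inI-in q cu) a)) cl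
    ... | inj₂ p | inj₂ q = closed g′ x u (proj₂ (st′-⊑ x p) cl) (trans (sym (c-out p)) cx) (trans (sym (c-out q)) cu) (out-adj p q a)

    -- In `S′` the vertex `w` stands for the part of `S` in `A`. A leaf of `S′` outside `A` is a
    -- leaf of `S`, as it has at most one neighbour in `A`. If `t` lies in `A`, rooting `S′` at `w`
    -- guarantees such a leaf; otherwise `w` may be the leaf, and the search continues inside `A`.
    forest-glue : Forest G c
    forest-glue S t S⊆F x₀ x₀∈S x₀≢t = start (any? (λ s → (s ∈? S) ×-dec (s ∈? A)))
      where
      Unique : Fin n → Set
      Unique v = ∀ y z → y ∈ S → z ∈ S → adj v y ≡ true → adj v z ≡ true → y ≡ z
      Goal : Set
      Goal = ∃ λ v → v ∈ S × v ≢ t × Unique v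

      S′ : VSet n
      S′ v = if A v then v == w else S v
      S′-out : ∀ {v} → v ∉ A → S′ v ≡ S v
      S′-out {v} p = cong (λ b → if b then v == w else S v) p
      S′-in : ∀ {v} → v ∈ A → S′ v ≡ v == w
      S′-in {v} p = cong (λ b → if b then v == w else S v) p
      w∈S′ : w ∈ S′
      w∈S′ = trans (S′-in w∈A) (==-refl w)
      S′⊆F : ∀ v → v ∈ S′ → c′ v ≡ inF
      S′⊆F v v∈S′ with in-or-out A v
      ... | inj₁ p = trans (cong c′ (==-true (trans (sym (S′-in p)) v∈S′))) w-inF
      ... | inj₂ p = trans (sym (c-out p)) (S⊆F v (trans (sym (S′-out p)) v∈S′))

      Unique′ : Fin n → Set
      Unique′ v = ∀ y z → y ∈ S′ → z ∈ S′ → adj′ v y ≡ true → adj′ v z ≡ true → y ≡ z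

      touches : ∀ {v y} → y ∈ A → y ∈ S → adj v y ≡ true → v ∈ touch BF
      touches {v} {y} y∈A y∈S a = touch-intro BF v y (inF-in y∈A (S⊆F y y∈S)) a

      lift : ∀ v → v ∉ A → v ∈ S → Unique′ v → Unique v
      lift v v∉A v∈S uniq y z y∈S z∈S ay az with in-or-out A y | in-or-out A z
      ... | inj₁ p | inj₁ q = one v y z v∉A (liveF v∉A (S⊆F v v∈S)) p q ay az
      ... | inj₁ p | inj₂ q = ⊥-elim (true≢false w∈A (subst (_∉ A) (sym (uniq w z w∈S′ (trans (S′-out q) z∈S)
        (trans (adj′-to-w v∉A) (touches p y∈S ay)) (out-adj v∉A q az))) q))
      ... | inj₂ p | inj₁ q = ⊥-elim (true≢false w∈A (subst (_∉ A) (sym (uniq w y w∈S′ (trans (S′-out p) y∈S)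
        (trans (adj′-to-w v∉A) (touches q z∈S az)) (out-adj v∉A p ay))) p))
      ... | inj₂ p | inj₂ q = uniq y z (trans (S′-out p) y∈S) (trans (S′-out q) z∈S) (out-adj v∉A p ay) (out-adj v∉A q az)

      SA : VSet n
      SA v = S v ∧ A v

      SA⊆F : ∀ v → v ∈ SA → cA v ≡ inF
      SA⊆F v p = trans (sym (c-in (proj₂ (∧-true p)))) (S⊆F v (proj₁ (∧-true p)))

      outside : (∀ s → s ∈ S → s ∉ A) → Goal
      outside S∩A with forest g′ S t (λ v v∈S → trans (sym (c-out (S∩A v v∈S))) (S⊆F v v∈S)) x₀ x₀∈S x₀≢t
      ... | v , v∈S , v≢t , uniq = v , v∈S , v≢t , λ y z y∈S z∈S ay az →
        uniq y z y∈S z∈S (out-adj (S∩A v v∈S) (S∩A y y∈S) ay) (out-adj (S∩A v v∈S) (S∩A z z∈S) az)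

      inside : (∀ s → s ∈ S → s ∈ A) → Goal
      inside S⊆A = forest gA S t (λ v v∈S → trans (sym (c-in (S⊆A v v∈S))) (S⊆F v v∈S)) x₀ x₀∈S x₀≢t

      root-inside : t ∈ A → Goal
      root-inside t∈A with any? (λ z → (z ∈? S) ×-dec (A z Bool.≟ false))
      ... | no none = inside all-in
        where
        all-in : ∀ s → s ∈ S → s ∈ A
        all-in s s∈S with in-or-out A s
        ... | inj₁ p = p
        ... | inj₂ p = ⊥-elim (none (s , s∈S , p))
      ... | yes (z , z∈S , z∉A)
        with forest g′ S′ w S′⊆F z (trans (S′-out z∉A) z∈S) (λ { refl → true≢false w∈A z∉A })
      ...   | v , v∈S′ , v≢w , uniq with in-or-out A v
      ...     | inj₁ p = ⊥-elim (v≢w (==-true (trans (sym (S′-in p)) v∈S′)))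
      ...     | inj₂ p = v , v∈S , (λ { refl → true≢false t∈A p }) , lift v p v∈S uniq
        where v∈S = trans (sym (S′-out p)) v∈S′

      -- The contracted vertex is a leaf of S′, so at most one edge of S leaves A; A is then rooted at the end of this edge.
      leaf-blob : t ∉ A → ∀ s → s ∈ S → s ∈ A → Unique′ w → Goal
      leaf-blob t∉A s s∈S s∈A uniq = pick exit
        where
        Exit : Fin n → Set
        Exit p = p ∈ S × p ∈ A × (∀ q z → q ∈ S → q ∈ A → z ∈ S → z ∉ A → adj q z ≡ true → q ≡ p)
        same : ∀ y z → y ∈ S → z ∈ S → y ∉ A → z ∉ A → y ∈ touch BF → z ∈ touch BF → y ≡ z
        same y z y∈S z∈S y∉A z∉A ty tz = uniq y z (trans (S′-out y∉A) y∈S) (trans (S′-out z∉A) z∈S)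
          (trans (adj′-w y∉A) ty) (trans (adj′-w z∉A) tz)
        exit : ∃ Exit
        exit with any? (λ p → (p ∈? S) ×-dec ((p ∈? A) ×-dec any? (λ z → (z ∈? S) ×-dec ((A z Bool.≟ false) ×-dec (adj p z Bool.≟ true)))))
        -- No edge of `S` leaves `A`, so any vertex of `S` in `A` can be the root there.
        ... | no none = s , s∈S , s∈A , λ q z q∈S q∈A z∈S z∉A a → ⊥-elim (none (q , q∈S , q∈A , z , z∈S , z∉A , a))
        ... | yes (p , p∈S , p∈A , z , z∈S , z∉A , a) = p , p∈S , p∈A , λ q z′ q∈S q∈A z′∈S z′∉A a′ →
          let e = same z′ z z′∈S z∈S z′∉A z∉A (touches q∈A q∈S (adj-sym a′)) (touches p∈A p∈S (adj-sym a))
          in one z q p z∉A (liveF z∉A (S⊆F z z∈S)) q∈A p∈A (subst (λ u → adj u q ≡ true) e (adj-sym a′)) (adj-sym a)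
        pick : ∃ Exit → Goal
        pick (p , p∈S , p∈A , only) with any? (λ q → (q ∈? SA) ×-dec ¬? (q ≟ p))
        ... | yes (q , q∈SA , q≢p) with forest gA SA p SA⊆F q q∈SA q≢p
        ...   | v , v∈SA , v≢p , u = v , v∈S , (λ { refl → true≢false v∈A t∉A }) ,
          λ y z y∈S z∈S ay az → u y z (∧-intro y∈S (stays y∈S ay)) (∧-intro z∈S (stays z∈S az)) ay az
          where
          v∈S = proj₁ (∧-true v∈SA)
          v∈A = proj₂ (∧-true v∈SA)
          stays : ∀ {y} → y ∈ S → adj v y ≡ true → y ∈ A
          stays {y} y∈S a with in-or-out A y
          ... | inj₁ q = q
          ... | inj₂ q = ⊥-elim (v≢p (only v y v∈S v∈A y∈S q a))
        -- `p` is the only vertex of `S` in `A`; it inherits from `w` the property of being a leaf.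
        pick (p , p∈S , p∈A , only) | no none = p , p∈S , (λ { refl → true≢false p∈A t∉A }) ,
          λ y z y∈S z∈S ay az → same y z y∈S z∈S (leaves y∈S ay) (leaves z∈S az)
            (touches p∈A p∈S (adj-sym ay)) (touches p∈A p∈S (adj-sym az))
          where
          leaves : ∀ {y} → y ∈ S → adj p y ≡ true → y ∉ A
          leaves {y} y∈S a with in-or-out A y
          ... | inj₂ q = q
          ... | inj₁ q = ⊥-elim (none (y , ∧-intro y∈S q , adj-≢ a ∘ sym))

      root-outside : t ∉ A → ∀ s → s ∈ S → s ∈ A → Goal
      root-outside t∉A s s∈S s∈A with forest g′ S′ t S′⊆F w w∈S′ (λ { refl → true≢false w∈A t∉A })
      ... | v , v∈S′ , v≢t , uniq with in-or-out A v
      ...   | inj₁ p = leaf-blob t∉A s s∈S s∈A (subst Unique′ (==-true (trans (sym (S′-in p)) v∈S′)) uniq)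
      ...   | inj₂ p = v , v∈S , v≢t , lift v p v∈S uniq
        where v∈S = trans (sym (S′-out p)) v∈S′

      start : Dec (∃ λ s → s ∈ S × s ∈ A) → Goal
      start (no none) = outside (λ s s∈S → ∉-intro {A = A} {s} (λ s∈A → none (s , s∈S , s∈A)))
      start (yes (s , s∈S , s∈A)) with in-or-out A t
      ... | inj₁ t∈A = root-inside t∈A
      ... | inj₂ t∉A = root-outside t∉A s s∈S s∈A

    glued : Good G st c
    glued = record { compat = compat-glue ; I-I = I-I-glue ; I-F-I = I-F-I-glue ; closed = closed-glue ; forest = forest-glue }

  module Sparsity (sparse : Sparse G st) (light : W st A ≤ 2 * E A + 2) where

    union-bound : ∀ A′ → A′ ⊆ live ∘ st → (∀ v → v ∈ A′ → v ∉ A) →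
      2 * (E A + 2 * cut A′ A + E A′) + 1 ≤ W st A + W st A′
    union-bound A′ A′⊆V apart = subst₂ (λ e m → 2 * e + 1 ≤ m) (E-union C-disjoint) (sum-union C-disjoint (wt ∘ st))
      (sparse (A ∪ A′) C⊆V w (cong (_∨ A′ w) w∈A))
      where
      C-disjoint = ∪-disjoint A A′ apart
      C⊆V : (A ∪ A′) ⊆ live ∘ st
      C⊆V v p with A v in eq
      ... | true = A⊆V v eq
      ... | false = A′⊆V v p

    -- Two edges into `A` cost 8, and `z` adds weight at most 5 to a potential of at most 2.
    one : ∀ z s s′ → z ∉ A → live (st z) ≡ true → s ∈ A → s′ ∈ A → adj z s ≡ true → adj z s′ ≡ true → s ≡ s′
    one z s s′ z∉A z∈V s∈A s′∈A a a′ with s ≟ s′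
    ... | yes e = e
    ... | no s≢s′ = ⊥-elim (bound (E A) (W st A) (wt (st z)) (deg A z) (deg-≥2 A z s s′ s≢s′ s∈A s′∈A a a′) (wt≤5 (st z)) light
      (subst₂ (λ e m → 2 * e + 1 ≤ m) (E-▷ z A z∉A) (W-▷ st z A z∉A)
        (sparse (z ▷ A) (▷-⊆ z A _ z∈V A⊆V) z (▷-here z A))))
      where
      wt≤5 : ∀ s → wt s ≤ 5
      wt≤5 X = z≤n
      wt≤5 P = ≤-refl
      wt≤5 F = m≤m+n 4 1
      wt≤5 N = m≤m+n 3 2
      wt≤5 D = m≤m+n 2 3
      bound : ∀ e a z d → 2 ≤ d → z ≤ 5 → a ≤ 2 * e + 2 → 2 * (e + 2 * d) + 1 ≤ z + a → ⊥
      bound e a z d p q r s = 1≰0 (linear 1 (+-mono-≤ (+-mono-≤ (scale 4 p) q) (+-mono-≤ r s)) (solve (e ∷ a ∷ z ∷ d ∷ [])))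
        where
        1≰0 : 1 ≤ 0 → ⊥
        1≰0 ()

    -- A set containing `w` is compared with its union with `A`: `w` weighs at least the potential
    -- of `A`, and a vertex touching the I-part loses at most 3 but drops an edge of cost 4. For a
    -- set without `w` no edge is dropped, and `extra` must cover the loss.
    sparse′ : (∀ A′ → A′ ⊆ live ∘ st → (∀ v → v ∈ A′ → v ∉ A) → ∀ x → x ∈ A′ →
        2 * E A′ + 3 * touching BI A′ + 1 ≤ W st A′) → Sparse G′ st′
    sparse′ extra B B⊆ x x∈B = by (in-or-out B w)
      where
      module E′ = Potential G′
      Bo : VSet n
      Bo v = B v ∧ not (A v)
      Bo-out : ∀ v → v ∈ Bo → v ∉ A
      Bo-out v p = not-true (proj₂ (∧-true p))
      Bo⊆V : Bo ⊆ live ∘ st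
      Bo⊆V v p = trans (sym (st′-live v (Bo-out v p))) (B⊆ v (proj₁ (∧-true p)))
      E-Bo : E′.E Bo ≡ E Bo
      E-Bo = sum-cong outer
        where
        outer : ∀ v → 𝟙 (Bo v) * E′.deg Bo v ≡ 𝟙 (Bo v) * deg Bo v
        outer v with Bo v in p
        ... | false = refl
        ... | true = cong (_+ 0) (sum-cong inner)
          where
          inner : ∀ u → 𝟙 (Bo u) * 𝟙 (adj′ v u) ≡ 𝟙 (Bo u) * 𝟙 (adj v u)
          inner u with Bo u in q
          ... | false = refl
          ... | true = cong (λ b → 1 * 𝟙 b) (adj′-out (Bo-out v p) (Bo-out u q))
      W-Bo : W st Bo ≤ W st′ Bo + 3 * touching BI Bo
      W-Bo = subst (λ m → W st Bo ≤ W st′ Bo + m)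
        (trans (sum-cong (λ v → rearrange (𝟙 (Bo v)) (𝟙 (touch BI v)))) (sum-* 3 (λ v → 𝟙 (Bo v) * 𝟙 (touch BI v))))
        (W-cost st st′ Bo (λ v → 3 * 𝟙 (touch BI v)) (λ v p → st′-cost v (Bo-out v p)))
        where
        rearrange : ∀ a b → a * (3 * b) ≡ 3 * (a * b)
        rearrange a b = solve (a ∷ b ∷ [])
      w∉Bo : w ∉ Bo
      w∉Bo rewrite w∈A with B w
      ... | true = refl
      ... | false = refl
      deg-w : E′.deg Bo w ≡ touching BF Bo
      deg-w = sum-cong term
        where
        term : ∀ v → 𝟙 (Bo v) * 𝟙 (adj′ w v) ≡ 𝟙 (Bo v) * 𝟙 (touch BF v)
        term v with Bo v in p
        ... | false = refl
        ... | true = cong (λ b → 1 * 𝟙 b) (adj′-w (Bo-out v p))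

      transfer : ∀ {B′} → (∀ v → B v ≡ B′ v) → 2 * E′.E B′ + 1 ≤ W st′ B′ → 2 * E′.E B + 1 ≤ W st′ B
      transfer h = subst₂ (λ e m → 2 * e + 1 ≤ m) (sym (E′.cut-cong h h))
        (sym (sum-cong (λ v → cong (λ b → 𝟙 b * wt (st′ v)) (h v))))

      without : w ∉ B → ∀ v → B v ≡ Bo v
      without w∉B v with B v in p | A v in q
      ... | false | _ = refl
      ... | true | false = refl
      ... | true | true = ⊥-elim (true≢false (subst (_∈ B) (st′-A v q (B⊆ v p)) p) w∉B)

      with-w : w ∈ B → ∀ v → B v ≡ (w ▷ Bo) v
      with-w w∈B v with v ≟ w
      ... | yes refl = w∈B
      ... | no v≢w with B v in p | A v in q
      ...   | false | _ = refl
      ...   | true | false = refl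
      ...   | true | true = ⊥-elim (v≢w (st′-A v q (B⊆ v p)))

      by : w ∈ B ⊎ w ∉ B → 2 * E′.E B + 1 ≤ W st′ B
      by (inj₂ w∉B) = transfer (without w∉B) (subst (λ e → 2 * e + 1 ≤ W st′ Bo) (sym E-Bo)
        (bound (E Bo) (W st Bo) (W st′ Bo) (touching BI Bo) (extra Bo Bo⊆V Bo-out x (trans (sym (without w∉B x)) x∈B)) W-Bo))
        where
        bound : ∀ e m m′ i → 2 * e + 3 * i + 1 ≤ m → m ≤ m′ + 3 * i → 2 * e + 1 ≤ m′
        bound e m m′ i p q = linear 0 (+-mono-≤ p q) (solve (e ∷ m ∷ m′ ∷ i ∷ []))
      by (inj₁ w∈B) = transfer (with-w w∈B) (subst₂ (λ e m → 2 * e + 1 ≤ m)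
        (sym (trans (E′.E-▷ w Bo w∉Bo) (cong₂ (λ e k → e + 2 * k) E-Bo deg-w)))
        (sym (trans (W-▷ st′ w Bo w∉Bo) (cong (λ s → wt s + W st′ Bo) st′-w)))
        (bound (E A) (E Bo) (cut Bo A) (W st A) (W st Bo) (W st′ Bo) (touching BF Bo) (touching BI Bo)
          (union-bound Bo Bo⊆V Bo-out) light W-Bo (touching-≤ A-disjoint Bo)))
        where
        bound : ∀ ea e k a m m′ f i → 2 * (ea + 2 * k + e) + 1 ≤ a + m → a ≤ 2 * ea + 2 → m ≤ m′ + 3 * i → f + i ≤ k →
          2 * (e + 2 * f) + 1 ≤ 2 + m′
        bound ea e k a m m′ f i p q r s = linear i (+-mono-≤ (+-mono-≤ p q) (+-mono-≤ r (scale 4 s)))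
          (solve (ea ∷ e ∷ k ∷ a ∷ m ∷ m′ ∷ f ∷ i ∷ []))

-- The induction on the number of live vertices.

size : ∀ {n} → (Fin n → State) → ℕ
size st = sumFin (λ v → 𝟙 (live (st v)))

size-< : ∀ {n} (st st′ : Fin n → State) → (live ∘ st′) ⊆ (live ∘ st) → ∀ r → live (st r) ≡ true → live (st′ r) ≡ false →
  size st′ < size st
size-< st st′ sub r l d = subst (_≤ size st) total (sum-mono term)
  where
  term : ∀ v → 𝟙 (v == r) * 1 + 𝟙 (live (st′ v)) ≤ 𝟙 (live (st v))
  term v with v ≟ r
  ... | yes refl rewrite l | d = ≤-refl
  ... | no _ with live (st′ v) in eq
  ...   | false = z≤n
  ...   | true rewrite sub v eq = ≤-refl
  total : sumFin (λ v → 𝟙 (v == r) * 1 + 𝟙 (live (st′ v))) ≡ suc (size st′)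
  total = trans (sum-+ (λ v → 𝟙 (v == r) * 1) (λ v → 𝟙 (live (st′ v)))) (cong (_+ size st′) (sum-δ r (λ _ → 1)))

all-off : ∀ {n} {G : Graph n} {st : Fin n → State} → (∀ v → st v ≡ X) → Good G st (λ _ → off)
all-off {st = st} dead = record
  { compat = λ v → subst (_allows off) (sym (dead v)) X-off
  ; I-I = λ _ _ () ; I-F-I = λ _ _ _ () ; closed = λ _ _ _ ()
  ; forest = λ S t S⊆F x x∈S → ⊥-elim (inF≢off (S⊆F x x∈S) refl)
  }

module Step {n : ℕ} (G : Graph n) (st : Fin n → State) (sparse : Sparse G st)
  (ih : ∀ (G′ : Graph n) (st′ : Fin n → State) → size st′ < size st → Sparse G′ st′ → Colourable G′ st′) where
  open Potential G
  open Touch G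

  V : VSet n
  V = live ∘ st

  Light : ℕ → VSet n → Set
  Light r A = (∀ v → v ∈ A → v ∈ V) × (∃ λ p → ∃ λ q → p ≢ q × p ∈ A × q ∈ A) × (∃ λ o → o ∈ V × o ∉ A) ×
    W st A ≤ 2 * E A + r

  light? : ∀ r A → Dec (Light r A)
  light? r A = all? (λ v → (v ∈? A) →-dec (v ∈? V)) ×-dec
    (any? (λ p → any? (λ q → ¬? (p ≟ q) ×-dec ((p ∈? A) ×-dec (q ∈? A)))) ×-dec
    (any? (λ o → (o ∈? V) ×-dec (A o Bool.≟ false)) ×-dec (W st A ≤? (2 * E A + r))))

  light-resp : ∀ r A B → (∀ v → A v ≡ B v) → Light r A → Light r B
  light-resp r A B h (sub , (p , q , p≢q , p∈A , q∈A) , (o , o∈V , o∉A) , bound) =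
    (λ v v∈B → sub v (trans (h v) v∈B)) ,
    (p , q , p≢q , trans (sym (h p)) p∈A , trans (sym (h q)) q∈A) ,
    (o , o∈V , trans (sym (h o)) o∉A) ,
    subst₂ (λ m e → m ≤ 2 * e + r) (sum-cong (λ v → cong (λ b → 𝟙 b * wt (st v)) (h v))) (cut-cong h h) bound

  find-light : ∀ r → ∃ (Light r) ⊎ (∀ A → ¬ Light r A)
  find-light r with anySubset? (λ s → light? r (lookup s))
  ... | yes (s , l) = inj₁ (lookup s , l)
  ... | no none = inj₂ (λ A l → none (tabulate A , light-resp r A _ (λ v → sym (lookup∘tabulate A v)) l))

  Gap : ℕ → Set
  Gap r = ∀ A → A ⊆ V → ∀ p q o → p ≢ q → p ∈ A → q ∈ A → o ∈ V → o ∉ A → 2 * E A + suc r ≤ W st A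

  none⇒gap : ∀ r → (∀ A → ¬ Light r A) → Gap r
  none⇒gap r none A A⊆V p q o p≢q p∈A q∈A o∈V o∉A with W st A ≤? (2 * E A + r)
  ... | yes l = ⊥-elim (none A (A⊆V , (p , q , p≢q , p∈A , q∈A) , (o , o∈V , o∉A) , l))
  ... | no ¬l = subst (_≤ W st A) (sym (+-suc (2 * E A) r)) (≰⇒> ¬l)

  module Contract (A : VSet n) (A⊆V : A ⊆ V) (p q o : Fin n) (p≢q : p ≢ q) (p∈A : p ∈ A) (q∈A : q ∈ A)
    (o∈V : o ∈ V) (o∉A : o ∉ A) (light : W st A ≤ 2 * E A + 2) where

    restrict-live : ∀ v → live (restrict st A v) ≡ true → v ∈ A
    restrict-live v l with A v
    ... | true = refl
    restrict-live v () | false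

    restrict-size : ∀ st′ → (∀ v → live (st′ v) ≡ live (restrict st A v)) → size st′ < size st
    restrict-size st′ h = size-< st st′ (λ v l → A⊆V v (restrict-live v (trans (sym (h v)) l))) o o∈V
      (trans (h o) (cong (λ b → live (if b then st o else X)) o∉A))

    restrict-W : ∀ B → B ⊆ A → W (restrict st A) B ≡ W st B
    restrict-W B B⊆A = sum-cong term
      where
      term : ∀ v → 𝟙 (B v) * wt (restrict st A v) ≡ 𝟙 (B v) * wt (st v)
      term v with B v in eq
      ... | false = refl
      ... | true rewrite B⊆A v eq = refl

    module Coloured (cA : Fin n → Colour) (gA : Good G (restrict st A) cA) where
      module C = Contraction G st A p p∈A A⊆V cA gA
      open C using (BI; BF)
      open C.Sparsity sparse light

      BI⊆A : BI ⊆ A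
      BI⊆A s b with in-or-out A s
      ... | inj₁ s∈A = s∈A
      ... | inj₂ s∉A = ⊥-elim (inI≢off (isI-true b) (C.off-A s∉A))

      -- `rich` offers three ways to pay 3 for each vertex of `A′` that touches the I-part:
      -- adjoining `A′` to `A` does not lower the potential, so 4 per crossing edge is at hand; or
      -- some crossing edge is in surplus, and `sparse` for the union suffices; or there is no
      -- crossing edge.
      glue : (∀ z → z ∉ A → z ∈ V → z ∈ touch BI → Open (st z)) →
        (∀ A′ → A′ ⊆ V → (∀ v → v ∈ A′ → v ∉ A) → ∀ x → x ∈ A′ →
          2 * E A′ + 4 * cut A′ A ≤ W st A′ ⊎ touching BI A′ + 1 ≤ cut A′ A ⊎ cut A′ A ≡ 0) → Colourable G st
      glue openI rich = finish (ih C.G′ C.st′ smaller (sparse′ extra))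
        where
        sub : (live ∘ C.st′) ⊆ V
        sub v l with in-or-out A v
        ... | inj₁ v∈A = A⊆V v v∈A
        ... | inj₂ v∉A = trans (sym (C.st′-live v v∉A)) l
        q-dead : live (C.st′ q) ≡ false
        q-dead with live (C.st′ q) in eq
        ... | false = refl
        ... | true = ⊥-elim (p≢q (sym (C.st′-A q q∈A eq)))
        smaller : size C.st′ < size st
        smaller = size-< st C.st′ sub q (A⊆V q q∈A) q-dead
        extra : ∀ A′ → A′ ⊆ V → (∀ v → v ∈ A′ → v ∉ A) → ∀ x → x ∈ A′ → 2 * E A′ + 3 * touching BI A′ + 1 ≤ W st A′
        extra A′ A′⊆V apart x x∈A′ = by (cut A′ A) refl (rich A′ A′⊆V apart x x∈A′)
          where
          i≤e : touching BI A′ ≤ cut A′ A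
          i≤e = ≤-trans (m≤n+m _ _) (touching-≤ C.A-disjoint A′)
          by : ∀ e → cut A′ A ≡ e → 2 * E A′ + 4 * cut A′ A ≤ W st A′ ⊎ touching BI A′ + 1 ≤ cut A′ A ⊎ cut A′ A ≡ 0 →
            2 * E A′ + 3 * touching BI A′ + 1 ≤ W st A′
          by zero eq _ = bound (E A′) (W st A′) (touching BI A′) (subst (touching BI A′ ≤_) eq i≤e) (sparse A′ A′⊆V x x∈A′)
            where
            bound : ∀ e m i → i ≤ 0 → 2 * e + 1 ≤ m → 2 * e + 3 * i + 1 ≤ m
            bound e m i h k = linear 0 (+-mono-≤ (scale 3 h) k) (solve (e ∷ m ∷ i ∷ []))
          by (suc k) eq (inj₁ h) = bound (E A′) (W st A′) (touching BI A′) k (subst (touching BI A′ ≤_) eq i≤e)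
            (subst (λ c → 2 * E A′ + 4 * c ≤ W st A′) eq h)
            where
            bound : ∀ e m i k → i ≤ suc k → 2 * e + 4 * suc k ≤ m → 2 * e + 3 * i + 1 ≤ m
            bound e m i k h h′ = linear k (+-mono-≤ (scale 3 h) h′) (solve (e ∷ m ∷ i ∷ k ∷ []))
          by (suc k) eq (inj₂ (inj₁ h)) = bound (E A) (E A′) (cut A′ A) (W st A) (W st A′) (touching BI A′) h
            (union-bound A′ A′⊆V apart) light
            where
            bound : ∀ ea e c a m i → i + 1 ≤ c → 2 * (ea + 2 * c + e) + 1 ≤ a + m → a ≤ 2 * ea + 2 → 2 * e + 3 * i + 1 ≤ m
            bound ea e c a m i h k l = linear (i + 2) (+-mono-≤ (scale 4 h) (+-mono-≤ k l)) (solve (ea ∷ e ∷ c ∷ a ∷ m ∷ i ∷ []))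
          by (suc k) eq (inj₂ (inj₂ e)) = ⊥-elim (0≢suc (trans (sym e) eq))
            where
            0≢suc : ∀ {m} → 0 ≡ suc m → ⊥
            0≢suc ()
        finish : Colourable C.G′ C.st′ → Colourable G st
        finish (c′ , g′) = C.Glue.c c′ g′ one openI , C.Glue.glued c′ g′ one openI

      -- The edge between `z` and `A` costs 4, so the potential can stay at `k` only if `z` weighs
      -- at least 4.
      heavy⇒Open : ∀ z s → z ∉ A → s ∈ A → adj z s ≡ true → ∀ k → W st A ≤ 2 * E A + k → 2 * E (z ▷ A) + k ≤ W st (z ▷ A) → Open (st z)
      heavy⇒Open z s z∉A s∈A a k l h = wt≥4⇒Open (st z) (bound (E A) (deg A z) (W st A) (wt (st z)) k
        (deg-≥1 A z s s∈A a) l (subst₂ (λ e m → 2 * e + k ≤ m) (E-▷ z A z∉A) (W-▷ st z A z∉A) h))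
        where
        bound : ∀ e d a z k → 1 ≤ d → a ≤ 2 * e + k → 2 * (e + 2 * d) + k ≤ z + a → 4 ≤ z
        bound e d a z k p q r = linear 0 (+-mono-≤ (scale 4 p) (+-mono-≤ q r)) (solve (e ∷ d ∷ a ∷ z ∷ k ∷ []))

      heavy⇒rich : ∀ A′ → (∀ v → v ∈ A′ → v ∉ A) → ∀ k → W st A ≤ 2 * E A + k →
        2 * E (A ∪ A′) + k ≤ W st (A ∪ A′) → 2 * E A′ + 4 * cut A′ A ≤ W st A′
      heavy⇒rich A′ apart k l h = bound (E A) (E A′) (cut A′ A) (W st A) (W st A′) k l
        (subst₂ (λ e m → 2 * e + k ≤ m) (E-union (∪-disjoint A A′ apart)) (sum-union (∪-disjoint A A′ apart) (wt ∘ st)) h)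
        where
        bound : ∀ ea e c a m k → a ≤ 2 * ea + k → 2 * (ea + 2 * c + e) + k ≤ a + m → 2 * e + 4 * c ≤ m
        bound ea e c a m k p q = linear 0 (+-mono-≤ p q) (solve (ea ∷ e ∷ c ∷ a ∷ m ∷ k ∷ []))

    ∪⊆V : ∀ A′ → A′ ⊆ V → (A ∪ A′) ⊆ V
    ∪⊆V A′ A′⊆V v m with A v in eq
    ... | true = A⊆V v eq
    ... | false = A′⊆V v m

    plain : Colourable G (restrict st A)
    plain = ih G (restrict st A) (restrict-size _ (λ _ → refl)) λ B B⊆ x x∈B →
      let B⊆A = λ v v∈B → restrict-live v (B⊆ v v∈B) in
      subst (2 * E B + 1 ≤_) (sym (restrict-W B B⊆A)) (sparse B (λ v → A⊆V v ∘ B⊆A v) x x∈B)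

    -- Potential 1 is the least that `sparse` permits, so no superset of `A` lies below `A`; both
    -- requirements of `glue` follow with `k` equal to 1.
    contract₁ : W st A ≤ 2 * E A + 1 → Colourable G st
    contract₁ light₁ = use plain
      where
      use : Colourable G (restrict st A) → Colourable G st
      use (cA , gA) = glue
          (λ z z∉A z∈V t → let (s , s∈BI , a) = touch-elim BI z t in
            heavy⇒Open z s z∉A (BI⊆A s s∈BI) a 1 light₁ (sparse (z ▷ A) (▷-⊆ z A V z∈V A⊆V) z (▷-here z A)))
          (λ A′ A′⊆V apart x x∈A′ → inj₁ (heavy⇒rich A′ apart 1 light₁
            (sparse (A ∪ A′) (∪⊆V A′ A′⊆V) p (cong (_∨ A′ p) p∈A))))
        where
        open Coloured cA gA
        open C using (BI)

    -- Without an edge leaving `A` there is no boundary vertex to force, but no demand is made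
    -- outside `A` either.
    isolated : (∀ s u → s ∈ A → u ∈ V → u ∉ A → adj s u ≡ true → ⊥) → Colourable G st
    isolated none = use plain
      where
      use : Colourable G (restrict st A) → Colourable G st
      use (cA , gA) = glue
          (λ z z∉A z∈V t → let (s , s∈BI , a) = touch-elim BI z t in ⊥-elim (none s z (BI⊆A s s∈BI) z∈V z∉A (adj-sym a)))
          (λ A′ A′⊆V apart x x∈A′ → inj₂ (inj₂ (sum-0 _ (zero-term A′ A′⊆V apart))))
        where
        open Coloured cA gA
        open C using (BI)
        zero-term : ∀ A′ → A′ ⊆ V → (∀ v → v ∈ A′ → v ∉ A) → ∀ v → 𝟙 (A′ v) * deg A v ≡ 0
        zero-term A′ A′⊆V apart v with A′ v in eq
        ... | false = refl
        ... | true with deg A v in ed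
        ...   | zero = refl
        ...   | suc k = let (s , s∈A , a , _) = deg-pick A v ed in
          ⊥-elim (none s v s∈A (A′⊆V v eq) (apart v eq) (adj-sym a))

    module Boundary (gap₁ : Gap 1) (s₀ u₀ : Fin n) (s₀∈A : s₀ ∈ A) (u₀∈V : u₀ ∈ V) (u₀∉A : u₀ ∉ A) (a₀ : adj s₀ u₀ ≡ true) where

      stF : Fin n → State
      stF = setF (restrict st A) s₀

      -- Every subset of `A` misses `o`, so with two vertices it has potential at least 2, and
      -- forcing `s₀` costs at most 1.
      sparseF : Sparse G stF
      sparseF B B⊆ x x∈B with any? (λ y → (y ∈? B) ×-dec ¬? (y ≟ x))
      ... | yes (y , y∈B , y≢x) = bound (E B) (W st B) (W stF B) (𝟙 (B s₀))
          (gap₁ B (λ v → A⊆V v ∘ B⊆A v) y x o y≢x y∈B x∈B o∈V o∉B)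
          (subst (_≤ W stF B + 1 * 𝟙 (B s₀)) (restrict-W B B⊆A) (setF-W (restrict st A) B s₀)) (𝟙≤1 (B s₀))
        where
        B⊆A : B ⊆ A
        B⊆A v v∈B = restrict-live v (trans (sym (setF-live (restrict st A) s₀ v)) (B⊆ v v∈B))
        o∉B : o ∉ B
        o∉B = ∉-intro {A = B} {o} (λ o∈B → true≢false (B⊆A o o∈B) o∉A)
        bound : ∀ e m m′ i → 2 * e + 2 ≤ m → m ≤ m′ + 1 * i → i ≤ 1 → 2 * e + 1 ≤ m′
        bound e m m′ i h k l = linear 0 (+-mono-≤ h (+-mono-≤ k l)) (solve (e ∷ m ∷ m′ ∷ i ∷ []))
      ... | no none = subst (λ e → 2 * e + 1 ≤ W stF B) (sym (E-single B x only))
          (≤-trans (s≤s z≤n) (W-single stF B x x∈B (B⊆ x x∈B)))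
        where
        only : ∀ y → y ∈ B → y ≡ x
        only y y∈B with y ≟ x
        ... | yes e = e
        ... | no y≢x = ⊥-elim (none (y , y∈B , y≢x))

      contract₂ : Colourable G st
      contract₂ = use (ih G stF (restrict-size stF (setF-live (restrict st A) s₀)) sparseF)
        where
        use : Colourable G stF → Colourable G st
        use (cA , gF) = glue openI rich
          where
          gA : Good G (restrict st A) cA
          gA = weaken (setF-⊑ (restrict st A) s₀) gF
          open Coloured cA gA
          open C using (BI; BF)
          open C.Sparsity sparse light using (one)
          s₀-inF : cA s₀ ≡ inF
          s₀-inF = setF-colour (restrict st A) s₀ (compat gF s₀)
            (trans (cong live (C.at-A s₀∈A)) (A⊆V s₀ s₀∈A))
          openI : ∀ z → z ∉ A → z ∈ V → z ∈ touch BI → Open (st z)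
          openI z z∉A z∈V t with any? (λ y → (y ∈? V) ×-dec ((z ▷ A) y Bool.≟ false))
          ... | yes (y , y∈V , y∉) = let (s , s∈BI , a) = touch-elim BI z t in
            heavy⇒Open z s z∉A (BI⊆A s s∈BI) a 2 light
              (gap₁ (z ▷ A) (▷-⊆ z A V z∈V A⊆V) p q y p≢q (▷-there z A p p∈A) (▷-there z A q q∈A) y∈V y∉)
          -- Here `z` is the only live vertex outside `A`, hence `u₀`, and its one neighbour in `A`
          -- is `s₀`, which is not in I.
          ... | no none = let (s , s∈BI , a) = touch-elim BI z t in
            ⊥-elim (inI≢inF (isI-true s∈BI) (trans (cong cA (one z s s₀ z∉A z∈V (BI⊆A s s∈BI) s₀∈A a
              (subst (λ y → adj y s₀ ≡ true) u₀≡z (adj-sym a₀)))) s₀-inF))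
            where
            u₀≡z : u₀ ≡ z
            u₀≡z with u₀ ≟ z
            ... | yes e = e
            ... | no u₀≢z = ⊥-elim (none (u₀ , u₀∈V , ▷-∉ z A u₀ u₀≢z u₀∉A))
          rich : ∀ A′ → A′ ⊆ V → (∀ v → v ∈ A′ → v ∉ A) → ∀ x → x ∈ A′ →
            2 * E A′ + 4 * cut A′ A ≤ W st A′ ⊎ touching BI A′ + 1 ≤ cut A′ A ⊎ cut A′ A ≡ 0
          rich A′ A′⊆V apart x x∈A′ with any? (λ y → (y ∈? V) ×-dec ((A ∪ A′) y Bool.≟ false))
          ... | yes (y , y∈V , y∉) = inj₁ (heavy⇒rich A′ apart 2 light (gap₁ (A ∪ A′) (∪⊆V A′ A′⊆V) p q y p≢q
            (cong (_∨ A′ p) p∈A) (cong (_∨ A′ q) q∈A) y∈V y∉))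
          -- `A` and `A′` exhaust `V`, so `gap₁` says nothing about their union. But `A′` contains
          -- `u₀`, whose edge to `s₀` comes from the forest part and is the surplus.
          ... | no none = inj₂ (inj₁ (≤-trans (+-monoʳ-≤ (touching BI A′) touched)
            (≤-trans (≤-reflexive (+-comm (touching BI A′) (touching BF A′))) (touching-≤ C.A-disjoint A′))))
            where
            u₀∈A′ : u₀ ∈ A′
            u₀∈A′ with A′ u₀ in eq
            ... | true = refl
            ... | false = ⊥-elim (none (u₀ , u₀∈V , trans (cong (_∨ A′ u₀) u₀∉A) eq))
            touched : 1 ≤ touching BF A′
            touched = subst (_≤ touching BF A′)
              (trans (∈⇒1* _ u₀∈A′) (cong 𝟙 (touch-intro BF u₀ s₀ (cong isF s₀-inF) (adj-sym a₀))))
              (term≤sum (λ v → 𝟙 (A′ v) * 𝟙 (touch BF v)) u₀)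

    contract₂ : Gap 1 → Colourable G st
    contract₂ gap₁ with any? (λ s → any? (λ u → (s ∈? A) ×-dec ((u ∈? V) ×-dec ((A u Bool.≟ false) ×-dec (adj s u Bool.≟ true)))))
    ... | yes (s , u , s∈A , u∈V , u∉A , a) = Boundary.contract₂ gap₁ s u s∈A u∈V u∉A a
    ... | no none = isolated (λ s u s∈A u∈V u∉A a → none (s , u , s∈A , u∈V , u∉A , a))

  step : Colourable G st
  step with any? (λ x → x ∈? V)
  ... | no none = _ , all-off (λ v → dead (st v) (λ l → none (v , l)))
    where
    dead : ∀ s → ¬ (live s ≡ true) → s ≡ X
    dead X _ = refl
    dead P h = ⊥-elim (h refl)
    dead F h = ⊥-elim (h refl)
    dead N h = ⊥-elim (h refl)
    dead D h = ⊥-elim (h refl)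
  ... | yes (x , x∈V) = first (find-light 1)
    where
    second : Gap 1 → ∃ (Light 2) ⊎ (∀ A → ¬ Light 2 A) → Colourable G st
    second gap₁ (inj₁ (A , A⊆V , (p , q , p≢q , p∈A , q∈A) , (o , o∈V , o∉A) , light)) =
      Contract.contract₂ A A⊆V p q o p≢q p∈A q∈A o∈V o∉A light gap₁
    second gap₁ (inj₂ none) = Discharging.colourable G st sparse (none⇒gap 2 none)
      (λ st′ sub r r∈V dead → ih G st′ (size-< st st′ sub r r∈V dead)) x x∈V
    first : ∃ (Light 1) ⊎ (∀ A → ¬ Light 1 A) → Colourable G st
    first (inj₁ (A , A⊆V , (p , q , p≢q , p∈A , q∈A) , (o , o∈V , o∉A) , light)) =
      Contract.contract₁ A A⊆V p q o p≢q p∈A q∈A o∈V o∉A (≤-trans light (+-monoʳ-≤ (2 * E A) (s≤s z≤n))) light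
    first (inj₂ none) = second (none⇒gap 1 none) (find-light 2)

-- `k` bounds the number of live vertices and makes the recursion structural; `G` varies along it
-- because of contraction.
sparse⇒colourable : ∀ k {n} (G : Graph n) st → size st ≤ k → Sparse G st → Colourable G st
sparse⇒colourable k {n} G st h sparse = Step.step G st sparse (ih k h)
  where
  ih : ∀ k → size st ≤ k → (G′ : Graph n) (st′ : Fin n → State) → size st′ < size st → Sparse G′ st′ → Colourable G′ st′
  ih zero h G′ st′ lt _ = ⊥-elim (n≮0 (≤-trans lt h))
  ih (suc k) h G′ st′ lt sp = sparse⇒colourable k G′ st′ (≤-pred (≤-trans lt h)) sp

-- Passage from the maximum average degree to potentials, and from good colourings to partitions.

T⇒≡ : ∀ {b} → T b → b ≡ true
T⇒≡ = Equivalence.to Bool.T-≡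

≡⇒T : ∀ {b} → b ≡ true → T b
≡⇒T = Equivalence.from Bool.T-≡

last-or-inject : ∀ {m} (i : Fin (suc m)) → i ≡ fromℕ m ⊎ ∃ λ j → i ≡ inject₁ j
last-or-inject i with view i
... | ‵fromℕ = inj₁ refl
... | ‵inject₁ j = inj₂ (j , refl)

module _ {n : ℕ} (G : Graph n) where
  open Potential G

  induced : VSet n → Subgraph G
  induced A = record
    { VH = A
    ; EH = λ u v → A u ∧ (A v ∧ adj u v)
    ; EH-sym = eh-sym
    ; EH⊆G = λ u v t → ≡⇒T (proj₂ (∧-true {A v} (proj₂ (∧-true {A u} (T⇒≡ t)))))
    ; EH-ends = λ u v t → ≡⇒T (proj₁ (∧-true {A u} (T⇒≡ t))) , ≡⇒T (proj₁ (∧-true {A v} (proj₂ (∧-true {A u} (T⇒≡ t)))))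
    }
    where
    eh-sym : ∀ u v → A u ∧ (A v ∧ adj u v) ≡ A v ∧ (A u ∧ adj v u)
    eh-sym u v rewrite Graph.sym G u v with A u | A v
    ... | true | true = refl
    ... | true | false = refl
    ... | false | true = refl
    ... | false | false = refl

  E≡2nE : ∀ A → E A ≡ 2 * nE (induced A)
  E≡2nE A = trans (sum-cong (λ u → trans (sym (sum-* (𝟙 (A u)) (λ v → 𝟙 (A v) * 𝟙 (adj u v))))
      (trans (sum-cong (λ v → term u v)) (sum-+ (L u) (λ v → L v u)))))
    (trans (sum-+ (λ u → sumFin (L u)) (λ u → sumFin (λ v → L v u)))
    (trans (cong (nE (induced A) +_) (sum-swap (λ u v → L v u))) (cong (nE (induced A) +_) (sym (+-identityʳ _)))))
    where
    H = induced A
    L : Fin n → Fin n → ℕ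
    L u v = if does (toℕ u <? toℕ v) then (if EH H u v then 1 else 0) else 0
    value : ∀ u v → 𝟙 (A u) * (𝟙 (A v) * 𝟙 (adj u v)) ≡ (if EH H u v then 1 else 0)
    value u v with A u | A v | adj u v
    ... | true | true | true = refl
    ... | true | true | false = refl
    ... | true | false | _ = refl
    ... | false | _ | _ = refl
    term : ∀ u v → 𝟙 (A u) * (𝟙 (A v) * 𝟙 (adj u v)) ≡ L u v + L v u
    term u v with toℕ u <ᵇ toℕ v in p | toℕ v <ᵇ toℕ u in q
    ... | true | true = ⊥-elim (<-asym (<ᵇ⇒< (toℕ u) (toℕ v) (≡⇒T p)) (<ᵇ⇒< (toℕ v) (toℕ u) (≡⇒T q)))
    ... | true | false = trans (value u v) (sym (+-identityʳ _))
    ... | false | true = trans (value u v) (cong (λ b → if b then 1 else 0) (EH-sym H u v))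
    ... | false | false = diagonal (toℕ-injective (≤-antisym (≮⇒≥ (not-< (toℕ v) (toℕ u) q)) (≮⇒≥ (not-< (toℕ u) (toℕ v) p))))
      where
      not-< : ∀ i j → (i <ᵇ j) ≡ false → ¬ i < j
      not-< i j e l = true≢false (T⇒≡ (<⇒<ᵇ l)) e
      diagonal : u ≡ v → 𝟙 (A u) * (𝟙 (A v) * 𝟙 (adj u v)) ≡ 0
      diagonal refl rewrite irrefl G u | *-zeroʳ (𝟙 (A u)) = *-zeroʳ (𝟙 (A u))

  mad⇒sparse : MadLessFiveHalves G → Sparse G (λ _ → P)
  mad⇒sparse mad A _ x x∈A = bound (E A) (nE (induced A)) (count A) (W (λ _ → P) A) (E≡2nE A) weight
    (mad (induced A) (≤-trans (≤-reflexive (sym one)) (term≤sum (λ v → if A v then 1 else 0) x)))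
    where
    one : (if A x then 1 else 0) ≡ 1
    one rewrite x∈A = refl
    weight : W (λ _ → P) A ≡ 5 * count A
    weight = trans (sum-cong term) (sum-* 5 (λ v → if A v then 1 else 0))
      where
      term : ∀ v → 𝟙 (A v) * 5 ≡ 5 * (if A v then 1 else 0)
      term v with A v
      ... | true = refl
      ... | false = refl
    bound : ∀ e m k w → e ≡ 2 * m → w ≡ 5 * k → 4 * m < 5 * k → 2 * e + 1 ≤ w
    bound _ m k _ refl refl h = linear 0 h (solve (m ∷ k ∷ []))

  module Cycle {S : VSet n} (cyc : CycleIn G S) where
    open CycleIn cyc

    vertices : VSet n
    vertices v = does (any? (λ i → vtx i ≟ v))

    vertices-intro : ∀ i → vtx i ∈ vertices
    vertices-intro i = dec-true (any? (λ j → vtx j ≟ vtx i)) (i , refl)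

    vertices-elim : ∀ v → v ∈ vertices → ∃ λ i → vtx i ≡ v
    vertices-elim v p = witness (any? (λ i → vtx i ≟ v)) p
      where
      witness : ∀ {Q : Set} (d : Dec Q) → does d ≡ true → Q
      witness (yes q) _ = q

    -- The cyclic predecessor and successor, distinct because a cycle has at least three vertices;
    -- the first and last index need `close`.
    two-neighbours : ∀ i → ∃₂ λ j k → j ≢ k × adj (vtx i) (vtx j) ≡ true × adj (vtx i) (vtx k) ≡ true
    two-neighbours zero = suc zero , fromℕ (suc (suc len)) , (λ ()) , T⇒≡ (step zero) , adj-sym (T⇒≡ close)
    two-neighbours (suc i) with last-or-inject (suc i)
    ... | inj₁ e = inject₁ i , zero , not-zero i e , adj-sym (T⇒≡ (step i)) ,
        subst (λ j → adj (vtx j) (vtx zero) ≡ true) (sym e) (T⇒≡ close)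
      where
      not-zero : (i : Fin (suc (suc len))) → suc i ≡ fromℕ (suc (suc len)) → inject₁ i ≢ zero
      not-zero zero ()
      not-zero (suc i) _ ()
    ... | inj₂ (j , e) = inject₁ i , suc j , apart , adj-sym (T⇒≡ (step i)) ,
        subst (λ k → adj (vtx k) (vtx (suc j)) ≡ true) (sym e) (T⇒≡ (step j))
      where
      apart : inject₁ i ≢ suc j
      apart q = m≢1+m+n (toℕ i) (trans (sym (toℕ-inject₁ i)) (trans (cong toℕ q) (cong suc
        (trans (sym (toℕ-inject₁ j)) (trans (cong toℕ (sym e)) (+-comm 1 (toℕ i)))))))

  -- Every vertex of a cycle has two neighbours on it, so the vertex set of the cycle, rooted at
  -- `vtx zero`, contradicts `Forest`.
  forest⇒acyclic : ∀ {c} → Forest G c → (∀ v → not (isI (c v)) ≡ true → c v ≡ inF) → InducedForest G (λ v → not (isI (c v)))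
  forest⇒acyclic {c} forest notI cyc = contradict (forest vertices (vtx zero) coloured (vtx (suc zero)) (vertices-intro (suc zero)) (1≢0 ∘ inj))
    where
    open CycleIn cyc
    open Cycle cyc
    1≢0 : suc zero ≢ zero {suc (suc len)}
    1≢0 ()
    coloured : ∀ v → v ∈ vertices → c v ≡ inF
    coloured v p with vertices-elim v p
    ... | i , refl = notI (vtx i) (T⇒≡ (inS i))
    contradict : (∃ λ v → v ∈ vertices × v ≢ vtx zero ×
      (∀ y z → y ∈ vertices → z ∈ vertices → adj v y ≡ true → adj v z ≡ true → y ≡ z)) → ⊥
    contradict (v , p , _ , unique) with vertices-elim v p
    ... | i , refl with two-neighbours i
    ...   | j , k , j≢k , aj , ak = j≢k (inj (unique (vtx j) (vtx k) (vertices-intro j) (vertices-intro k) aj ak))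

  colouring⇒partition : Colourable G (λ _ → P) → IFPartition G
  colouring⇒partition (c , g) = (λ v → isI (c v)) , independent , forest⇒acyclic (forest g) notI
    where
    colour : ∀ v → c v ≡ inI ⊎ c v ≡ inF
    colour v = live-colour (compat g v) refl
    notI : ∀ v → not (isI (c v)) ≡ true → c v ≡ inF
    notI v p with colour v
    ... | inj₂ e = e
    ... | inj₁ e = ⊥-elim (true≢false (cong isI e) (not-true p))
    independent : TwoIndependent G (λ v → isI (c v))
    independent u v tu tv u≢v = (λ a → I-I g u v cu cv (T⇒≡ a)) , λ x (a , b) → common x (T⇒≡ a) (T⇒≡ b) (colour x)
      where
      cu = isI-true (T⇒≡ tu)
      cv = isI-true (T⇒≡ tv)
      common : ∀ x → adj u x ≡ true → adj x v ≡ true → c x ≡ inI ⊎ c x ≡ inF → ⊥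
      common x a b (inj₁ cx) = I-I g u x cu cx a
      common x a b (inj₂ cx) = u≢v (I-F-I g x u v cx cu cv (adj-sym a) b)

theorem3 : ∀ {n : ℕ} (G : Graph n) → MadLessFiveHalves G → IFPartition G
theorem3 G mad = colouring⇒partition G (sparse⇒colourable (size st) G st ≤-refl (mad⇒sparse G mad))
  where
  st = λ _ → P
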